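{- Let $p$ be an odd prime with $p\equiv 2\pmod 3$, and let $$T_p=\left[\frac{1}{i^2-ij+j^2}\right]_{1\le i,j\le p-1},$$ a $(p-1)\times(p-1)$ matrix with rational entries. Then $2\det T_p$ is a quadratic residue modulo $p$.
   Context: The entries of $T_p$ are rational numbers whose denominators are not divisible by $p$, so $2\det T_p$ is a rational number that is a $p$-adic integer and may be reduced modulo $p$ to an element of $\mathbb{F}_p=\mathbb{Z}/p\mathbb{Z}$. A $p$-adic integer is called a quadratic residue modulo $p$ if its reduction modulo $p$ is a nonzero square in $\mathbb{F}_p$. -}

module Defs where

open import Algebra.Bundles using (RawRing)
open import Data.Fin.Base using (Fin; zero; suc; toℕ; punchIn)
open import Data.Integer.Base as ℤ using (ℤ; +_; +[1+_]; 0ℤ)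
import Data.Integer.Divisibility as ℤ
import Data.Integer.Properties as ℤ
open import Data.Integer.Solver using (module +-*-Solver)
open import Data.Nat.Base as ℕ using (ℕ; zero; suc; _∸_)
import Data.Nat.Divisibility as ℕ
open import Data.Nat.DivMod using (_mod_)
open import Data.Product.Base using (∃; _×_)
open import Data.Rational.Base as ℚ using (ℚ; _/_; 1/_; ↥_; ↧_; ↧ₙ_)
import Data.Rational.Properties as ℚ
open import Relation.Binary.PropositionalEquality
  using (_≡_; _≢_; refl; sym; trans; cong; subst)
open import Relation.Nullary using (¬_)

module Determinant {c ℓ} (R : RawRing c ℓ) where
  open RawRing R
  open import Algebra.Definitions.RawSemiring rawSemiring using (sum; _^_)

  Matrix : ℕ → ℕ → Set c
  Matrix m n = Fin m → Fin n → Carrier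

  minor : ∀ {m n} → Matrix (suc m) (suc n) → Fin (suc m) → Fin (suc n) → Matrix m n
  minor A i j k l = A (punchIn i k) (punchIn j l)

  -- Laplace expansion along the first row.
  det : ∀ {n} → Matrix n n → Carrier
  det {zero}  A = 1#
  det {suc n} A = sum λ j → ((- 1#) ^ toℕ j) * (A zero j * det (minor A zero j))

open Determinant ℚ.+-*-rawRing public using (Matrix; minor; det)

form : ℤ → ℤ → ℤ
form i j = i ℤ.* i ℤ.- i ℤ.* j ℤ.+ j ℤ.* j

form-square : ∀ i j → form i j ≡ (i ℤ.- j) ℤ.* (i ℤ.- j) ℤ.+ i ℤ.* j
form-square = solve 2 (λ i j → i :* i :- i :* j :+ j :* j
                            := (i :- j) :* (i :- j) :+ i :* j) refl
  where open +-*-Solver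

square-nonNeg : ∀ i → 0ℤ ℤ.≤ i ℤ.* i
square-nonNeg (+ n)        = subst (0ℤ ℤ.≤_) (ℤ.pos-* n n) (ℤ.+≤+ ℕ.z≤n)
square-nonNeg (ℤ.-[1+ n ]) = ℤ.+≤+ ℕ.z≤n

form-positive : ∀ m n → 0ℤ ℤ.< form +[1+ m ] +[1+ n ]
form-positive m n = subst (0ℤ ℤ.<_) (sym (form-square +[1+ m ] +[1+ n ]))
  (ℤ.+-mono-≤-< (square-nonNeg (+[1+ m ] ℤ.- +[1+ n ])) (ℤ.+<+ (ℕ.s≤s ℕ.z≤n)))

integer-nonZero : ∀ {i} → i ≢ 0ℤ → ℚ.NonZero (i / 1)
integer-nonZero {i} i≢0 = ℚ.≢-nonZero λ i/1≡0 → i≢0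
  (trans (sym (ℚ.↥-/ i 1))
         (cong (ℤ._* ℤ.gcd i (+ 1)) (ℚ.p≡0⇒↥p≡0 (i / 1) i/1≡0)))
  where import Data.Integer.GCD as ℤ

-- The index k : Fin (p ∸ 1) stands for the integer toℕ k + 1 ∈ {1, …, p − 1}.
T : ∀ p → Matrix (p ∸ 1) (p ∸ 1)
T p k l = 1/_ (form +[1+ toℕ k ] +[1+ toℕ l ] / 1)
  {{integer-nonZero λ eq → ℤ.<⇒≢ (form-positive (toℕ k) (toℕ l)) (sym eq)}}

-- The rational q lies in ℤₚ.  Rationals are stored in lowest terms.
IsPAdicInteger : ℕ → ℚ → Set
IsPAdicInteger p q = ¬ (p ℕ.∣ ↧ₙ q)

-- q = a / b lies in ℤₚ and c, an element of 𝔽ₚ represented in {0, …, p − 1}, is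
-- its reduction: b · c = a in 𝔽ₚ.  For p prime this determines c, as p ∤ b.
ReducesTo : (p : ℕ) → ℚ → Fin p → Set
ReducesTo p q c = IsPAdicInteger p q × + p ℤ.∣ ↧ q ℤ.* + toℕ c ℤ.- ↥ q

IsNonZeroSquare : (p : ℕ) .{{_ : ℕ.NonZero p}} → Fin p → Set
IsNonZeroSquare p c = toℕ c ≢ 0 × ∃ λ (x : Fin p) → (toℕ x ℕ.* toℕ x) mod p ≡ c

IsQuadraticResidue : (p : ℕ) .{{_ : ℕ.NonZero p}} → ℚ → Set
IsQuadraticResidue p q = ∃ λ (c : Fin p) → ReducesTo p q c × IsNonZeroSquare p c

{-# OPTIONS --safe #-}

-- Let u_j be the inverse of x_j = j modulo p and put r = x_i u_j.  Since
-- i² − ij + j² = x_j² (r² − r + 1) and r^(p−1) = 1, expanding 1 / (r² − r + 1) in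
-- powers of r factors T_p modulo p as V C W E, where V = [x_i^k], W = [u_j^k],
-- C is the diagonal matrix of the coefficients c_k / 3 and E that of the u_j².
-- The powers of r sum to −1 if r = 1 and to 0 otherwise, so V W = −1, and p − 1
-- is even, so up to nonzero squares det T_p is the product of the c_k.  The
-- c_k run through 1, 2, 1, −1, −2, −1 periodically, so for p = 5 + 6m twice their
-- product is (−4)^(m+1), a square unless m is even; but then p ≡ 1 (mod 4) and −1
-- is a square.

module Submission where

open import Algebra.Bundles using (RawRing; CommutativeRing)
open import Data.Fin.Base using (Fin; zero; suc; toℕ; fromℕ; fromℕ<; punchIn; inject₁)
open import Data.Fin.Induction using (<-weakInduction)
import Data.Fin.Properties as Fin
open import Data.Integer.Base as ℤ using (ℤ; +_; -[1+_]; +[1+_]; 0ℤ; 1ℤ; -1ℤ)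
import Data.Integer.DivMod as ℤ
open import Data.Integer.Divisibility.Signed as ℤ using (divides)
import Data.Integer.Properties as ℤ
open import Data.Integer.Solver using (module +-*-Solver)
open import Data.Nat.Base as ℕ using (ℕ; zero; suc; _!; _%_)
open import Data.Nat.Combinatorics using (nCn≡1; nCk≡n!/k![n-k]!; k![n∸k]!∣n!)
  renaming (_C_ to _choose_)
import Data.Nat.Coprimality as Coprimality
open import Data.Nat.Divisibility as ℕ using (_∣_)
import Data.Nat.DivMod as ℕ
open import Data.Nat.Primality using (Prime; euclidsLemma; prime⇒nonTrivial; prime⇒nonZero)
import Data.Nat.Properties as ℕ
import Data.Nat.Solver as ℕ
open import Data.Product.Base using (_,_; ∃; proj₁; proj₂)
open import Data.Rational.Base as ℚ using (ℚ; mkℚ; 1/_; _/_; toℚᵘ)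
import Data.Rational.Properties as ℚ
open import Data.Rational.Unnormalised.Base as ℚᵘ using (ℚᵘ; mkℚᵘ; _≃_; *≡*)
import Data.Rational.Unnormalised.Properties as ℚᵘ
open import Data.Sum.Base as Sum using (_⊎_; inj₁; inj₂; [_,_]′)
open import Data.Vec.Functional using (_∷_; tail; insertAt; removeAt)
open import Defs hiding (Matrix; minor; det)
open import Function.Base using (_∘_)
open import Level using (0ℓ; _⊔_)
open import Relation.Binary.PropositionalEquality as ≡ using (_≡_; _≢_; _≗_)
open import Relation.Nullary using (¬_; Dec; yes; no; contradiction)
open import Relation.Nullary.Decidable using (map′)

-- The polynomial r² - r + 1 divides r⁶ - 1, hence the period 6 of the coefficients, and for p ≠ 3
-- its roots modulo p are the elements of order 6. As p = 5 + 6m, the number 6 does not divide p -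
-- 1, so there are no such roots and the inverse exists at every ratio r. Truncated at r^(p-1) = 1,
-- the series times r² - r + 1 is the constant 3, which explains the denominators of the c_k / 3. V
-- and W are of Vandermonde type, but their determinants enter only as a product, which V W = -1
-- gives directly. The same equation makes W invertible modulo p, so its rows are distinct; this
-- supplies an element whose power (p - 1)/2 is -1, and from it the square root of -1. The main
-- obstacle is that a determinant defined by Laplace expansion is not visibly multiplicative.
-- Multiplicativity is derived from the uniqueness of alternating multilinear functions of the rows,
-- over any commutative ring; here the ring is ℤ with congruence modulo p as its equality.

-- Determinants over two related rings

module RelatedDeterminants {c₁ ℓ₁ c₂ ℓ₂ r}
  (R : RawRing c₁ ℓ₁) (S : RawRing c₂ ℓ₂)
  (_∼_ : RawRing.Carrier R → RawRing.Carrier S → Set r)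
  where

  private
    module R where
      open RawRing R public
      open import Algebra.Definitions.RawSemiring rawSemiring public using (sum; _^_)
      open Determinant R public
    module S where
      open RawRing S public
      open import Algebra.Definitions.RawSemiring rawSemiring public using (sum; _^_)
      open Determinant S public

  -- A relation takes the place of a homomorphism because reduction modulo p is defined on only a
  -- part of ℚ. With `_≈_` as the relation of a ring to itself, the same record shows that `det`
  -- respects equality.
  record Compatible : Set (c₁ ⊔ c₂ ⊔ r) where
    field
      0-rel : R.0# ∼ S.0#
      1-rel : R.1# ∼ S.1#
      +-rel : ∀ {x y x′ y′} → x ∼ x′ → y ∼ y′ → (x R.+ y) ∼ (x′ S.+ y′)
      *-rel : ∀ {x y x′ y′} → x ∼ x′ → y ∼ y′ → (x R.* y) ∼ (x′ S.* y′)
      neg-rel : ∀ {x x′} → x ∼ x′ → (R.- x) ∼ (S.- x′)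

    ^-rel : ∀ {x x′} n → x ∼ x′ → (x R.^ n) ∼ (x′ S.^ n)
    ^-rel zero    x∼x′ = 1-rel
    ^-rel (suc n) x∼x′ = *-rel x∼x′ (^-rel n x∼x′)

    sum-rel : ∀ {n} {f : Fin n → R.Carrier} {g : Fin n → S.Carrier} →
              (∀ i → f i ∼ g i) → R.sum f ∼ S.sum g
    sum-rel {zero}  f∼g = 0-rel
    sum-rel {suc n} f∼g = +-rel (f∼g zero) (sum-rel (f∼g ∘ suc))

    det-rel : ∀ {n} {A : R.Matrix n n} {B : S.Matrix n n} →
              (∀ i j → A i j ∼ B i j) → R.det A ∼ S.det B
    det-rel {zero}  A∼B = 1-rel
    det-rel {suc n} A∼B = sum-rel λ j →
      *-rel (^-rel (toℕ j) (neg-rel 1-rel))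
            (*-rel (A∼B zero j) (det-rel λ k l → A∼B (suc k) (punchIn j l)))

-- Multilinear and alternating functions of the rows of a matrix

module DeterminantProperties {c ℓ} (R : CommutativeRing c ℓ) where

  open CommutativeRing R hiding (zero)
  open Determinant rawRing
  open import Algebra.Properties.Ring ring using (-1*x≈-x; -‿involutive; +-inverseˡ-unique)
  open import Algebra.Properties.Semiring.Exp semiring using (_^_)
  open import Algebra.Properties.Semiring.Sum semiring
  open import Algebra.Definitions.RawSemiring (RawRing.rawSemiring rawRing) using (product)
  open import Algebra.Solver.Ring.NaturalCoefficients.Default commutativeSemiring
    using (solve; con; _:+_; _:*_; _:=_)
  open import Relation.Binary.Reasoning.Setoid setoid

  private
    variable
      m n : ℕ

  compatible : RelatedDeterminants.Compatible rawRing rawRing _≈_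
  compatible = record
    { 0-rel = refl ; 1-rel = refl ; +-rel = +-cong ; *-rel = *-cong ; neg-rel = -‿cong }

  open RelatedDeterminants.Compatible compatible public
    using () renaming (det-rel to det-cong)

  -- sum computes on Fin (suc n), so the two vectors cannot be inferred from it.
  sum-cong : ∀ (f g : Fin n → Carrier) → (∀ i → f i ≈ g i) → sum f ≈ sum g
  sum-cong f g = sum-cong-≋

  sum-zero : {f : Fin n → Carrier} → (∀ i → f i ≈ 0#) → sum f ≈ 0#
  sum-zero {n = n} f≈0 = trans (sum-cong-≋ f≈0) (sum-replicate-zero n)

  sum-linear : ∀ {a b c : Fin n → Carrier} x →
               (∀ i → c i ≈ x * a i + b i) → sum c ≈ x * sum a + sum b
  sum-linear {a = a} {b} {c} x c≈ = begin
    sum c                              ≈⟨ sum-cong-≋ c≈ ⟩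
    sum (λ i → x * a i + b i)          ≈⟨ ∑-distrib-+ _ b ⟩
    sum (λ i → x * a i) + sum b        ≈⟨ +-congʳ (*-distribˡ-sum x a) ⟨
    x * sum a + sum b                  ∎

  -1² : - 1# * - 1# ≈ 1#
  -1² = trans (-1*x≈-x (- 1#)) (-‿involutive 1#)

  x+-1*x≈0 : ∀ x → x + - 1# * x ≈ 0#
  x+-1*x≈0 x = trans (+-congˡ (-1*x≈-x x)) (-‿inverseʳ x)

  -- Linearity is stated for any three matrices that agree off row `i`, so that no row has to be
  -- replaced explicitly. The shape need not be square: fixing the top row leaves a function of
  -- fewer rows of the same length.
  record Multilinear (F : Matrix m n → Carrier) : Set (c ⊔ ℓ) where
    field
      cong   : ∀ {A B} → (∀ i l → A i l ≈ B i l) → F A ≈ F B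
      linear : ∀ i {A B C} x →
               (∀ l → C i l ≈ x * A i l + B i l) →
               (∀ k → k ≢ i → ∀ l → C k l ≈ A k l) →
               (∀ k → k ≢ i → ∀ l → C k l ≈ B k l) →
               F C ≈ x * F A + F B

    zero-row : ∀ i {A} → (∀ l → A i l ≈ 0#) → F A ≈ 0#
    zero-row i {A} Ai≈0 = begin
      -- A zero row is -1 times itself plus itself, so `A` plays all three parts.
      F A                  ≈⟨ linear i {A} {A} (- 1#) row (λ _ _ _ → refl) (λ _ _ _ → refl) ⟩
      - 1# * F A + F A     ≈⟨ +-comm _ _ ⟩
      F A + - 1# * F A     ≈⟨ x+-1*x≈0 (F A) ⟩
      0#                   ∎
      where
      row : ∀ l → A i l ≈ - 1# * A i l + A i l
      row l = begin
        A i l                     ≈⟨ Ai≈0 l ⟩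
        0#                        ≈⟨ x+-1*x≈0 (A i l) ⟨
        A i l + - 1# * A i l      ≈⟨ +-comm _ _ ⟩
        - 1# * A i l + A i l      ∎

  -- Only rows a and b of a matrix matter here, so alternation in that pair of
  -- rows is all that is assumed; it is what the induction for det provides.
  module _ {F : Matrix m n → Carrier} (F-multilinear : Multilinear F)
           {a b : Fin m} (a≢b : a ≢ b)
           (vanishes : ∀ {A} → (∀ l → A a l ≈ A b l) → F A ≈ 0#) where

    open Multilinear F-multilinear

    private
      module _ (A : Matrix m n) where
        replace : (Fin n → Carrier) → (Fin n → Carrier) → Matrix m n
        replace u v k with k Fin.≟ a | k Fin.≟ b
        ... | yes _ | _     = u
        ... | no _  | yes _ = v
        ... | no _  | no _  = A k

        replace-a : ∀ {u v} l → replace u v a l ≈ u l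
        replace-a l with a Fin.≟ a
        ... | yes _   = refl
        ... | no  a≢a = contradiction ≡.refl a≢a

        replace-b : ∀ {u v} l → replace u v b l ≈ v l
        replace-b l with b Fin.≟ a | b Fin.≟ b
        ... | yes b≡a | _       = contradiction (≡.sym b≡a) a≢b
        ... | no _    | yes _   = refl
        ... | no _    | no  b≢b = contradiction ≡.refl b≢b

        replace-cong : ∀ {u v} {B : Matrix m n} → (∀ l → u l ≈ B a l) → (∀ l → v l ≈ B b l) →
                       (∀ k → k ≢ a → k ≢ b → ∀ l → A k l ≈ B k l) →
                       ∀ k l → replace u v k l ≈ B k l
        replace-cong u≈ v≈ A≈ k l with k Fin.≟ a | k Fin.≟ b
        ... | yes ≡.refl | _          = u≈ l
        ... | no _       | yes ≡.refl = v≈ l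
        ... | no k≢a     | no k≢b     = A≈ k k≢a k≢b l

        off-a : ∀ u u′ v k → k ≢ a → ∀ l → replace u v k l ≈ replace u′ v k l
        off-a u u′ v k k≢a l with k Fin.≟ a | k Fin.≟ b
        ... | yes k≡a | _     = contradiction k≡a k≢a
        ... | no _    | yes _ = refl
        ... | no _    | no _  = refl

        off-b : ∀ u v v′ k → k ≢ b → ∀ l → replace u v k l ≈ replace u v′ k l
        off-b u v v′ k k≢b l with k Fin.≟ a | k Fin.≟ b
        ... | yes _ | _       = refl
        ... | no _  | yes k≡b = contradiction k≡b k≢b
        ... | no _  | no _    = refl

        add-a : ∀ u u′ v → F (replace (λ l → u l + u′ l) v) ≈
                           F (replace u v) + F (replace u′ v)
        add-a u u′ v = trans
          (linear a 1# (λ l → trans (replace-a l) (+-cong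
             (sym (trans (*-identityˡ _) (replace-a l))) (sym (replace-a l))))
             (off-a _ u v) (off-a _ u′ v))
          (+-congʳ (*-identityˡ _))

        add-b : ∀ u v v′ → F (replace u (λ l → v l + v′ l)) ≈
                           F (replace u v) + F (replace u v′)
        add-b u v v′ = trans
          (linear b 1# (λ l → trans (replace-b l) (+-cong
             (sym (trans (*-identityˡ _) (replace-b l))) (sym (replace-b l))))
             (off-b u _ v) (off-b u _ v′))
          (+-congʳ (*-identityˡ _))

        diagonal : ∀ u → F (replace u u) ≈ 0#
        diagonal u = vanishes λ l → trans (replace-a l) (sym (replace-b l))

    -- Polarisation: with u + v in both rows F vanishes; expanding in both rows leaves the two mixed
    -- terms, since those with u twice or v twice vanish as well.
    swap : ∀ {A B} → (∀ l → A a l ≈ B b l) → (∀ l → A b l ≈ B a l) →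
           (∀ k → k ≢ a → k ≢ b → ∀ l → A k l ≈ B k l) → F A ≈ - F B
    swap {A} {B} Aa≈Bb Ab≈Ba A≈B = +-inverseˡ-unique _ _ (begin
      F A + F B                          ≈⟨ +-cong
        (cong {A} {⟨ u , v ⟩} λ k l → sym (replace-cong A {u} {v} {A}
          (λ _ → refl) (λ _ → refl) (λ _ _ _ _ → refl) k l))
        (cong {B} {⟨ v , u ⟩} λ k l → sym (replace-cong A {v} {u} {B} Ab≈Ba Aa≈Bb A≈B k l)) ⟩
      F ⟨ u , v ⟩ + F ⟨ v , u ⟩            ≈⟨ +-cong (+-identityˡ _) (+-identityʳ _) ⟨
      (0# + F ⟨ u , v ⟩) + (F ⟨ v , u ⟩ + 0#)
        ≈⟨ +-cong (+-congʳ (diagonal A u)) (+-congˡ (diagonal A v)) ⟨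
      (F ⟨ u , u ⟩ + F ⟨ u , v ⟩) + (F ⟨ v , u ⟩ + F ⟨ v , v ⟩)
        ≈⟨ +-cong (add-b A u u v) (add-b A v u v) ⟨
      F ⟨ u , u+v ⟩ + F ⟨ v , u+v ⟩        ≈⟨ add-a A u v u+v ⟨
      F ⟨ u+v , u+v ⟩                     ≈⟨ diagonal A u+v ⟩
      0#                                 ∎)
      where
      u v u+v : Fin n → Carrier
      u = A a
      v = A b
      u+v l = u l + v l
      ⟨_,_⟩ : (Fin n → Carrier) → (Fin n → Carrier) → Matrix m n
      ⟨_,_⟩ = replace A

  record Alternating (F : Matrix m n → Carrier) : Set (c ⊔ ℓ) where
    field
      multilinear : Multilinear F
      vanishes    : ∀ {i j} → i ≢ j → ∀ {A} → (∀ l → A i l ≈ A j l) → F A ≈ 0#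

    open Multilinear multilinear public

    row-swap : ∀ {i j} → i ≢ j → ∀ {A B} →
               (∀ l → A i l ≈ B j l) → (∀ l → A j l ≈ B i l) →
               (∀ k → k ≢ i → k ≢ j → ∀ l → A k l ≈ B k l) → F A ≈ - F B
    row-swap i≢j = swap multilinear i≢j (vanishes i≢j)

  -- The Laplace expansion is multilinear and alternating

  det-linear : ∀ (i : Fin n) {A B C} x →
               (∀ l → C i l ≈ x * A i l + B i l) →
               (∀ k → k ≢ i → ∀ l → C k l ≈ A k l) →
               (∀ k → k ≢ i → ∀ l → C k l ≈ B k l) →
               det C ≈ x * det A + det B
  det-linear zero {A} {B} {C} x row C≈A C≈B = sum-linear x λ j → let s = (- 1#) ^ toℕ j in begin
    s * (C zero j * det (minor C zero j))
      ≈⟨ *-congˡ (*-congʳ (row j)) ⟩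
    s * ((x * A zero j + B zero j) * det (minor C zero j))
      ≈⟨ solve 5 (λ s x a b d → s :* ((x :* a :+ b) :* d) :=
           x :* (s :* (a :* d)) :+ s :* (b :* d)) refl s x (A zero j) (B zero j) _ ⟩
    x * (s * (A zero j * det (minor C zero j))) + s * (B zero j * det (minor C zero j))
      ≈⟨ +-cong
           (*-congˡ (*-congˡ (*-congˡ (det-cong λ k l → C≈A (suc k) (λ ()) (punchIn j l)))))
           (*-congˡ (*-congˡ (det-cong λ k l → C≈B (suc k) (λ ()) (punchIn j l)))) ⟩
    x * (s * (A zero j * det (minor A zero j))) + s * (B zero j * det (minor B zero j)) ∎
  det-linear (suc i) {A} {B} {C} x row C≈A C≈B = sum-linear x λ j → let s = (- 1#) ^ toℕ j in begin
    s * (C zero j * det (minor C zero j))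
      ≈⟨ *-congˡ (*-congˡ (det-linear i x (λ l → row (punchIn j l))
           (λ k k≢i l → C≈A (suc k) (k≢i ∘ Fin.suc-injective) (punchIn j l))
           (λ k k≢i l → C≈B (suc k) (k≢i ∘ Fin.suc-injective) (punchIn j l)))) ⟩
    s * (C zero j * (x * det (minor A zero j) + det (minor B zero j)))
      ≈⟨ solve 5 (λ s x c a b → s :* (c :* (x :* a :+ b)) :=
           x :* (s :* (c :* a)) :+ s :* (c :* b)) refl s x (C zero j) _ _ ⟩
    x * (s * (C zero j * det (minor A zero j))) + s * (C zero j * det (minor B zero j))
      ≈⟨ +-cong (*-congˡ (*-congˡ (*-congʳ (C≈A zero (λ ()) j))))
                (*-congˡ (*-congʳ (C≈B zero (λ ()) j))) ⟩
    x * (s * (A zero j * det (minor A zero j))) + s * (B zero j * det (minor B zero j)) ∎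

  det-multilinear : Multilinear (det {n})
  det-multilinear = record { cong = det-cong ; linear = det-linear }

  -- Removing the columns j and punchIn j k can be done in either order, and the
  -- two corresponding terms have opposite signs.
  double-expansion : ∀ (r : Fin (suc (suc n)) → Carrier)
    (P : (Fin n → Fin (suc (suc n))) → Carrier) → (∀ {f g} → f ≗ g → P f ≈ P g) →
    sum (λ j → sum λ k → ((- 1#) ^ toℕ j * (- 1#) ^ toℕ k) *
      ((r j * r (punchIn j k)) * P (λ l → punchIn j (punchIn k l)))) ≈ 0#
  double-expansion {n} r P P-cong = begin
    sum (t zero) + sum (λ j → t (suc j) zero + sum (λ k → t (suc j) (suc k)))
      ≈⟨ +-congˡ (∑-distrib-+ (λ j → t (suc j) zero) (λ j → sum λ k → t (suc j) (suc k))) ⟩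
    sum (t zero) + (sum (λ j → t (suc j) zero) + sum (λ j → sum λ k → t (suc j) (suc k)))
      ≈⟨ +-assoc _ _ _ ⟨
    (sum (t zero) + sum (λ j → t (suc j) zero)) + sum (λ j → sum λ k → t (suc j) (suc k))
      ≈⟨ +-cong (trans (sym (∑-distrib-+ (t zero) (λ j → t (suc j) zero))) (sum-zero edge))
           (interior n r P P-cong) ⟩
    0# + 0#
      ≈⟨ +-identityˡ 0# ⟩
    0# ∎
    where
    t : Fin (suc (suc n)) → Fin (suc n) → Carrier
    t j k = ((- 1#) ^ toℕ j * (- 1#) ^ toℕ k) *
      ((r j * r (punchIn j k)) * P (λ l → punchIn j (punchIn k l)))

    -- Both terms remove the columns 0 and k + 1, but their sign exponents are k and k + 1.
    edge : ∀ k → t zero k + t (suc k) zero ≈ 0#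
    edge k = trans (+-congˡ (solve 5 (λ u s a b p →
        ((u :* s) :* con 1) :* ((b :* a) :* p) := u :* ((con 1 :* s) :* ((a :* b) :* p)))
        refl (- 1#) ((- 1#) ^ toℕ k) (r zero) (r (suc k)) _))
      (x+-1*x≈0 (t zero k))

    interior : ∀ n (r : Fin (suc (suc n)) → Carrier)
      (P : (Fin n → Fin (suc (suc n))) → Carrier) → (∀ {f g} → f ≗ g → P f ≈ P g) →
      sum (λ j → sum λ k → ((- 1#) ^ toℕ (suc j) * (- 1#) ^ toℕ (suc k)) *
        ((r (suc j) * r (punchIn (suc j) (suc k))) *
         P (λ l → punchIn (suc j) (punchIn (suc k) l)))) ≈ 0#
    interior zero    r P P-cong = +-identityˡ 0#
    interior (suc n) r P P-cong = trans
      (sum-cong (λ j → sum (after j)) (λ j → sum (before j)) λ j →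
        sum-cong (after j) (before j) λ k →
          *-cong (signs (toℕ j) (toℕ k)) (*-congˡ (P-cong λ { zero → ≡.refl ; (suc l) → ≡.refl })))
      -- When neither removed column is column 0, that column survives; it is handed to `P` as a
      -- fixed first column, and the same sum over one column fewer remains.
      (double-expansion (r ∘ suc) (λ f → P (zero ∷ (suc ∘ f)))
        (λ f≗g → P-cong λ { zero → ≡.refl ; (suc l) → ≡.cong suc (f≗g l) }))
      where
      before after : Fin (suc (suc n)) → Fin (suc n) → Carrier
      before j k = ((- 1#) ^ toℕ j * (- 1#) ^ toℕ k) *
        ((r (suc j) * r (suc (punchIn j k))) * P (zero ∷ λ l → suc (punchIn j (punchIn k l))))
      after j k = ((- 1#) ^ toℕ (suc j) * (- 1#) ^ toℕ (suc k)) *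
        ((r (suc j) * r (suc (punchIn j k))) * P (λ l → punchIn (suc j) (punchIn (suc k) l)))

      signs : ∀ j k → (- 1#) ^ suc j * (- 1#) ^ suc k ≈ (- 1#) ^ j * (- 1#) ^ k
      signs j k = begin
        (- 1# * (- 1#) ^ j) * (- 1# * (- 1#) ^ k)
          ≈⟨ solve 3 (λ u a b → (u :* a) :* (u :* b) := (u :* u) :* (a :* b)) refl _ _ _ ⟩
        (- 1# * - 1#) * ((- 1#) ^ j * (- 1#) ^ k)   ≈⟨ *-congʳ -1² ⟩
        1# * ((- 1#) ^ j * (- 1#) ^ k)              ≈⟨ *-identityˡ _ ⟩
        (- 1#) ^ j * (- 1#) ^ k                     ∎

  -- Two equal rows below row zero stay equal in every minor of the expansion.
  det-vanishes-suc : (∀ {i j : Fin n} → i ≢ j → ∀ {A} → (∀ l → A i l ≈ A j l) → det A ≈ 0#) →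
                     ∀ {i j : Fin n} → i ≢ j → ∀ {A} →
                     (∀ l → A (suc i) l ≈ A (suc j) l) → det A ≈ 0#
  det-vanishes-suc minor-vanishes {i} {j} i≢j {A} Ai≈Aj = sum-zero λ k → begin
    (- 1#) ^ toℕ k * (A zero k * det (minor A zero k))
      ≈⟨ *-congˡ (*-congˡ (minor-vanishes i≢j λ l → Ai≈Aj (punchIn k l))) ⟩
    (- 1#) ^ toℕ k * (A zero k * 0#)
      ≈⟨ trans (*-congˡ (zeroʳ _)) (zeroʳ _) ⟩
    0# ∎

  -- Expanding along row zero and then along row one, which has the same entries, gives the sum of
  -- `double-expansion`; `P` is the determinant of the remaining rows in the chosen columns.
  det-vanishes-01 : ∀ {A : Matrix (suc (suc n)) (suc (suc n))} →
                    (∀ l → A zero l ≈ A (suc zero) l) → det A ≈ 0#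
  det-vanishes-01 {n} {A} A₀≈A₁ = begin
    det A
      ≈⟨ sum-cong (λ j → (- 1#) ^ toℕ j * (A zero j * det (minor A zero j)))
           (λ j → sum (t j)) expand ⟩
    sum (λ j → sum (t j))
      ≈⟨ double-expansion (A zero) P
           (λ f≗g → det-cong λ i l → reflexive (≡.cong (A (suc (suc i))) (f≗g l))) ⟩
    0# ∎
    where
    P : (Fin n → Fin (suc (suc n))) → Carrier
    P f = det λ i l → A (suc (suc i)) (f l)

    t u : Fin (suc (suc n)) → Fin (suc n) → Carrier
    t j k = ((- 1#) ^ toℕ j * (- 1#) ^ toℕ k) *
      ((A zero j * A zero (punchIn j k)) * P (λ l → punchIn j (punchIn k l)))
    u j k = (- 1#) ^ toℕ k * (A (suc zero) (punchIn j k) * P (λ l → punchIn j (punchIn k l)))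

    expand : ∀ j → (- 1#) ^ toℕ j * (A zero j * det (minor A zero j)) ≈ sum (t j)
    expand j = begin
      (- 1#) ^ toℕ j * (A zero j * sum (u j))
        ≈⟨ *-assoc _ _ _ ⟨
      ((- 1#) ^ toℕ j * A zero j) * sum (u j)
        ≈⟨ *-distribˡ-sum _ (u j) ⟩
      sum (λ k → ((- 1#) ^ toℕ j * A zero j) * u j k)
        ≈⟨ sum-cong (λ k → ((- 1#) ^ toℕ j * A zero j) * u j k) (t j) (λ k → trans
             (*-congˡ (*-congˡ (*-congʳ (sym (A₀≈A₁ (punchIn j k))))))
             (solve 5 (λ s a t b p → (s :* a) :* (t :* (b :* p)) :=
                (s :* t) :* ((a :* b) :* p)) refl
                ((- 1#) ^ toℕ j) (A zero j) ((- 1#) ^ toℕ k) (A zero (punchIn j k)) _)) ⟩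
      sum (t j) ∎

  -- Exchanging row one with the row equal to row zero reduces to `det-vanishes-01`. The sign change
  -- under this exchange comes from `swap`, whose assumption concerns two rows below row zero and so
  -- already follows from the minors.
  det-vanishes-first : (∀ {i j : Fin n} → i ≢ j → ∀ {A} → (∀ l → A i l ≈ A j l) → det A ≈ 0#) →
                       ∀ (j : Fin n) {A} → (∀ l → A zero l ≈ A (suc j) l) → det A ≈ 0#
  det-vanishes-first minor-vanishes zero {A} = det-vanishes-01 {A = A}
  det-vanishes-first {suc n} minor-vanishes (suc j) {A} A₀≈Aj = begin
    det A     ≈⟨ swap det-multilinear 1≢j (λ {C} → det-vanishes-suc minor-vanishes (λ ()) {C})
                   {A} {B} (λ l → reflexive (≡.cong (λ r → r l) (≡.sym B-j))) (λ _ → refl) rest ⟩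
    - det B   ≈⟨ -‿cong (det-vanishes-01 {A = B} A₀≈Aj) ⟩
    - 0#      ≈⟨ trans (sym (-1*x≈-x 0#)) (zeroʳ (- 1#)) ⟩
    0#        ∎
    where
    1≢j : suc zero ≢ suc (suc j)
    1≢j ()

    B : Matrix (suc (suc n)) (suc (suc n))
    B zero          = A zero
    B (suc zero)    = A (suc (suc j))
    B (suc (suc k)) with k Fin.≟ j
    ... | yes _ = A (suc zero)
    ... | no _  = A (suc (suc k))

    B-j : B (suc (suc j)) ≡ A (suc zero)
    B-j with j Fin.≟ j
    ... | yes _  = ≡.refl
    ... | no j≢j = contradiction ≡.refl j≢j

    rest : ∀ k → k ≢ suc zero → k ≢ suc (suc j) → ∀ l → A k l ≈ B k l
    rest zero          _   _   l = refl
    rest (suc zero)    k≢1 _   l = contradiction ≡.refl k≢1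
    rest (suc (suc k)) _   k≢j l with k Fin.≟ j
    ... | yes k≡j = contradiction (≡.cong (λ i → suc (suc i)) k≡j) k≢j
    ... | no _    = refl

  det-vanishes : ∀ {i j : Fin n} → i ≢ j → ∀ {A} → (∀ l → A i l ≈ A j l) → det A ≈ 0#
  det-vanishes {i = zero}  {zero}  i≢j     _     = contradiction ≡.refl i≢j
  det-vanishes {i = suc i} {suc j} i≢j {A} Ai≈Aj =
    det-vanishes-suc det-vanishes (i≢j ∘ ≡.cong suc) {A} Ai≈Aj
  det-vanishes {i = zero}  {suc j} i≢j {A} Ai≈Aj =
    det-vanishes-first det-vanishes j {A} Ai≈Aj
  det-vanishes {i = suc i} {zero}  i≢j {A} Ai≈Aj =
    det-vanishes-first det-vanishes i {A} (λ l → sym (Ai≈Aj l))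

  -- Uniqueness of the determinant among alternating functions

  δ : Fin m → Fin n → Carrier
  δ zero    zero    = 1#
  δ zero    (suc _) = 0#
  δ (suc _) zero    = 0#
  δ (suc i) (suc j) = δ i j

  sum-δˡ : ∀ (i : Fin n) f → sum (λ k → δ i k * f k) ≈ f i
  sum-δˡ zero    f = trans (+-cong (*-identityˡ (f zero)) (sum-zero λ k → zeroˡ (f (suc k))))
                           (+-identityʳ _)
  sum-δˡ (suc i) f = trans (+-cong (zeroˡ (f zero)) (sum-δˡ i (λ k → f (suc k)))) (+-identityˡ _)

  sum-δʳ : ∀ (l : Fin n) f → sum (λ k → f k * δ k l) ≈ f l
  sum-δʳ zero    f = trans (+-cong (*-identityʳ (f zero)) (sum-zero λ k → zeroʳ (f (suc k))))
                           (+-identityʳ _)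
  sum-δʳ (suc l) f = trans (+-cong (zeroʳ (f zero)) (sum-δʳ l (λ k → f (suc k)))) (+-identityˡ _)

  -- Entry `j` is zeroed by removal and reinsertion so that an erased row of `A` is by definition a
  -- row of the minor with 0 put back, the form used in `border`.
  erase : Fin (suc n) → (Fin (suc n) → Carrier) → Fin (suc n) → Carrier
  erase j v = insertAt (removeAt v j) j 0#

  decompose : ∀ (j : Fin (suc n)) v l → v l ≈ v j * δ j l + erase j v l
  decompose         zero    v zero    = sym (trans (+-identityʳ _) (*-identityʳ _))
  decompose         zero    v (suc l) = sym (trans (+-congʳ (zeroʳ _)) (+-identityˡ _))
  decompose {suc n} (suc j) v zero    = sym (trans (+-congʳ (zeroʳ _)) (+-identityˡ _))
  decompose {suc n} (suc j) v (suc l) = decompose j (v ∘ suc) l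

  insertAt-cong : ∀ (j : Fin (suc n)) {v w : Fin n → Carrier} → (∀ l → v l ≈ w l) →
                  ∀ l → insertAt v j 0# l ≈ insertAt w j 0# l
  insertAt-cong         zero    v≈w zero    = refl
  insertAt-cong         zero    v≈w (suc l) = v≈w l
  insertAt-cong {suc n} (suc j) v≈w zero    = v≈w zero
  insertAt-cong {suc n} (suc j) v≈w (suc l) = insertAt-cong j (v≈w ∘ suc) l

  insertAt-linear : ∀ (j : Fin (suc n)) {u v w : Fin n → Carrier} x →
    (∀ l → w l ≈ x * u l + v l) →
    ∀ l → insertAt w j 0# l ≈ x * insertAt u j 0# l + insertAt v j 0# l
  insertAt-linear         zero    x w≈ zero    = sym (trans (+-identityʳ _) (zeroʳ x))
  insertAt-linear         zero    x w≈ (suc l) = w≈ l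
  insertAt-linear {suc n} (suc j) x w≈ zero    = w≈ zero
  insertAt-linear {suc n} (suc j) x w≈ (suc l) = insertAt-linear j x (w≈ ∘ suc) l

  insertAt-δ : ∀ (j : Fin (suc n)) (k : Fin n) l → insertAt (δ k) j 0# l ≡ δ (punchIn j k) l
  insertAt-δ zero    k       zero    = ≡.refl
  insertAt-δ zero    k       (suc l) = ≡.refl
  insertAt-δ (suc j) zero    zero    = ≡.refl
  insertAt-δ (suc j) zero    (suc l) = zeros j l
    where
    zeros : ∀ (j : Fin (suc n)) l → insertAt (λ _ → 0#) j 0# l ≡ 0#
    zeros         zero    zero    = ≡.refl
    zeros         zero    (suc l) = ≡.refl
    zeros {suc n} (suc j) zero    = ≡.refl
    zeros {suc n} (suc j) (suc l) = zeros j l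
  insertAt-δ (suc j) (suc k) zero    = ≡.refl
  insertAt-δ (suc j) (suc k) (suc l) = insertAt-δ j k l

  linear-head : ∀ {F : Matrix (suc m) n → Carrier} → Multilinear F → ∀ {k}
    (x : Fin k → Carrier) (v : Fin k → Fin n → Carrier) rest →
    F ((λ l → sum λ i → x i * v i l) ∷ rest) ≈ sum λ i → x i * F (v i ∷ rest)
  linear-head F-ml {zero}  x v rest = Multilinear.zero-row F-ml zero (λ _ → refl)
  linear-head F-ml {suc k} x v rest = trans
    (Multilinear.linear F-ml zero (x zero) (λ _ → refl) off off)
    (+-congˡ (linear-head F-ml (x ∘ suc) (v ∘ suc) rest))
    where
    off : ∀ {u w} k → k ≢ zero → ∀ l → (u ∷ rest) k l ≈ (w ∷ rest) k l
    off zero    k≢0 l = contradiction ≡.refl k≢0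
    off (suc k) _   l = refl

  multilinear-tail : ∀ {F : Matrix (suc m) n → Carrier} → Multilinear F → ∀ v →
                     Multilinear (λ A → F (v ∷ A))
  multilinear-tail F-ml v = record
    { cong   = λ A≈B → cong λ { zero l → refl ; (suc i) l → A≈B i l }
    ; linear = λ i x row C≈A C≈B → linear (suc i) x row (off C≈A) (off C≈B)
    }
    where
    open Multilinear F-ml
    off : ∀ {i A B} → (∀ k → k ≢ i → ∀ l → A k l ≈ B k l) →
          ∀ k → k ≢ suc i → ∀ l → (v ∷ A) k l ≈ (v ∷ B) k l
    off A≈B zero    _    l = refl
    off A≈B (suc k) k≢si l = A≈B k (k≢si ∘ ≡.cong suc) l

  -- Each row is a multiple of `δ j` plus its erased form, and the part with `δ j` contributes
  -- nothing. The rows are treated one at a time, each being fixed once it is erased.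
  erase-column : ∀ {F : Matrix m (suc n) → Carrier} → Multilinear F → ∀ j →
    (∀ {A} i → (∀ l → A i l ≈ δ j l) → F A ≈ 0#) →
    ∀ A → F A ≈ F (λ i → erase j (A i))
  erase-column {zero}      F-ml j F-vanishes A = Multilinear.cong F-ml λ ()
  erase-column {suc m} {F = F} F-ml j F-vanishes A = begin
    F A
      ≈⟨ linear zero {δ j ∷ tail A} {erase j (A zero) ∷ tail A} (A zero j)
           (decompose j (A zero)) off off ⟩
    A zero j * F (δ j ∷ tail A) + F (erase j (A zero) ∷ tail A)
      ≈⟨ +-cong (trans (*-congˡ (F-vanishes zero λ _ → refl)) (zeroʳ _))
           (erase-column (multilinear-tail F-ml (erase j (A zero))) j
             (λ i Ai≈δj → F-vanishes (suc i) Ai≈δj) (tail A)) ⟩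
    0# + F (erase j (A zero) ∷ λ i → erase j (A (suc i)))
      ≈⟨ +-identityˡ _ ⟩
    F (erase j (A zero) ∷ λ i → erase j (A (suc i)))
      ≈⟨ cong (λ { zero l → refl ; (suc i) l → refl }) ⟩
    F (λ i → erase j (A i)) ∎
    where
    open Multilinear F-ml
    off : ∀ {u} k → k ≢ zero → ∀ l → A k l ≈ (u ∷ tail A) k l
    off zero    k≢0 l = contradiction ≡.refl k≢0
    off (suc k) _   l = refl

  module _ {F : Matrix (suc n) (suc n) → Carrier} (F-alternating : Alternating F) where

    open Alternating F-alternating

    -- Surrounds `B` by a pivot 1 in row zero and column `j`, with zeros elsewhere in that row and
    -- column. Through it F becomes an alternating function of a smaller matrix.
    border : Fin (suc n) → Matrix n n → Matrix (suc n) (suc n)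
    border j B = δ j ∷ λ k → insertAt (B k) j 0#

    border-alternating : ∀ j → Alternating (F ∘ border j)
    border-alternating j = record
      { multilinear = record
        { cong   = λ A≈B → ml.cong λ k → insertAt-cong j (A≈B k)
        ; linear = λ i x row C≈A C≈B → ml.linear i x (insertAt-linear j x row)
            (λ k k≢i → insertAt-cong j (C≈A k k≢i)) (λ k k≢i → insertAt-cong j (C≈B k k≢i))
        }
      ; vanishes = λ i≢k Ai≈Ak → vanishes (i≢k ∘ Fin.suc-injective) (insertAt-cong j Ai≈Ak)
      }
      where module ml = Multilinear (multilinear-tail multilinear (δ j))

    -- Column `j` can be cleared below the pivot, because a lower row equal to `δ j` would repeat
    -- row zero.
    border-det : ∀ j A → F (δ j ∷ tail A) ≈ F (border j (minor A zero j))
    border-det j A = erase-column (multilinear-tail multilinear (δ j)) j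
      (λ i Ai≈δj → vanishes {zero} {suc i} (λ ()) (λ l → sym (Ai≈δj l))) (tail A)

    -- The matrix `border j δ` is the identity with row j moved to the top. Passing from j to j + 1
    -- exchanges row zero with row j + 1, at the cost of one sign.
    border-δ : ∀ j → F (border j δ) ≈ (- 1#) ^ toℕ j * F δ
    border-δ = <-weakInduction _ base step
      where
      base : F (border zero δ) ≈ 1# * F δ
      base = trans (cong λ { zero l → refl ; (suc k) l → reflexive (insertAt-δ zero k l) })
                   (sym (*-identityˡ _))

      punchIn-inject₁ : ∀ {n} (j : Fin n) → punchIn (inject₁ j) j ≡ suc j
      punchIn-inject₁ zero    = ≡.refl
      punchIn-inject₁ (suc j) = ≡.cong suc (punchIn-inject₁ j)

      punchIn-suc : ∀ {n} (j : Fin n) → punchIn (suc j) j ≡ inject₁ j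
      punchIn-suc zero    = ≡.refl
      punchIn-suc (suc j) = ≡.cong suc (punchIn-suc j)

      punchIn-other : ∀ {n} (j k : Fin n) → k ≢ j → punchIn (suc j) k ≡ punchIn (inject₁ j) k
      punchIn-other zero    zero    k≢j = contradiction ≡.refl k≢j
      punchIn-other zero    (suc k) k≢j = ≡.refl
      punchIn-other (suc j) zero    k≢j = ≡.refl
      punchIn-other (suc j) (suc k) k≢j = ≡.cong suc (punchIn-other j k (k≢j ∘ ≡.cong suc))

      step : ∀ j → F (border (inject₁ j) δ) ≈ (- 1#) ^ toℕ (inject₁ j) * F δ →
             F (border (suc j) δ) ≈ (- 1#) ^ suc (toℕ j) * F δ
      step j ih = begin
        F (border (suc j) δ)
          ≈⟨ row-swap {zero} {suc j} (λ ())
               (λ l → reflexive (≡.sym (row (inject₁ j) j (punchIn-inject₁ j) l)))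
               (λ l → reflexive (row (suc j) j (punchIn-suc j) l)) rest ⟩
        - F (border (inject₁ j) δ)
          ≈⟨ -‿cong ih ⟩
        - ((- 1#) ^ toℕ (inject₁ j) * F δ)
          ≈⟨ -1*x≈-x _ ⟨
        - 1# * ((- 1#) ^ toℕ (inject₁ j) * F δ)
          ≈⟨ *-assoc _ _ _ ⟨
        (- 1# * (- 1#) ^ toℕ (inject₁ j)) * F δ
          ≡⟨ ≡.cong (λ e → (- 1# * (- 1#) ^ e) * F δ) (Fin.toℕ-inject₁ j) ⟩
        (- 1# * (- 1#) ^ toℕ j) * F δ ∎
        where
        row : ∀ (i : Fin (suc n)) k {k′} → punchIn i k ≡ k′ → ∀ l → insertAt (δ k) i 0# l ≡ δ k′ l
        row i k ≡.refl l = insertAt-δ i k l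
        rest : ∀ k → k ≢ zero → k ≢ suc j → ∀ l → border (suc j) δ k l ≈ border (inject₁ j) δ k l
        rest zero    k≢0 _    l = contradiction ≡.refl k≢0
        rest (suc k) _   k≢sj l = reflexive (≡.trans
          (row (suc j) k (punchIn-other j k (k≢sj ∘ ≡.cong suc)) l)
          (≡.sym (insertAt-δ (inject₁ j) k l)))

  -- Row zero is expanded in unit vectors. For each of them F is an alternating function of the
  -- minor, to which induction applies, and `border-δ` supplies the Laplace sign.
  alternating⇒det : ∀ {F : Matrix n n → Carrier} → Alternating F → ∀ A → F A ≈ det A * F δ
  alternating⇒det {zero}  F-alt A = trans (Alternating.cong F-alt λ ()) (sym (*-identityˡ _))
  alternating⇒det {suc n} {F} F-alt A = begin
    F A
      ≈⟨ Alternating.cong F-alt (λ { zero l → sym (sum-δʳ l (λ j → A zero j)) ; (suc i) l → refl }) ⟩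
    F ((λ l → sum λ j → A zero j * δ j l) ∷ tail A)
      ≈⟨ linear-head (Alternating.multilinear F-alt) (A zero) δ (tail A) ⟩
    sum (λ j → A zero j * F (δ j ∷ tail A))
      ≈⟨ sum-cong (λ j → A zero j * F (δ j ∷ tail A)) (λ j → t j * F δ) term ⟩
    sum (λ j → t j * F δ)
      ≈⟨ *-distribʳ-sum (F δ) t ⟨
    det A * F δ ∎
    where
    t : Fin (suc n) → Carrier
    t j = (- 1#) ^ toℕ j * (A zero j * det (minor A zero j))

    term : ∀ j → A zero j * F (δ j ∷ tail A) ≈ t j * F δ
    term j = begin
      A zero j * F (δ j ∷ tail A)
        ≈⟨ *-congˡ (border-det F-alt j A) ⟩
      A zero j * F (border F-alt j (minor A zero j))
        ≈⟨ *-congˡ (alternating⇒det (border-alternating F-alt j) (minor A zero j)) ⟩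
      A zero j * (det (minor A zero j) * F (border F-alt j δ))
        ≈⟨ *-congˡ (*-congˡ (border-δ F-alt j)) ⟩
      A zero j * (det (minor A zero j) * ((- 1#) ^ toℕ j * F δ))
        ≈⟨ solve 4 (λ a d s f → a :* (d :* (s :* f)) := (s :* (a :* d)) :* f)
             refl (A zero j) (det (minor A zero j)) ((- 1#) ^ toℕ j) (F δ) ⟩
      t j * F δ ∎

  -- Matrix products, diagonal matrices and column scaling

  infixl 7 _⊗_
  _⊗_ : ∀ {k} → Matrix m k → Matrix k n → Matrix m n
  (A ⊗ B) i l = sum λ k → A i k * B k l

  -- For fixed `B` the left side is alternating in the rows of `A`, with value det B at the
  -- identity.
  det-⊗ : ∀ (A B : Matrix n n) → det (A ⊗ B) ≈ det A * det B
  det-⊗ A B = trans (alternating⇒det ⊗-alternating A)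
                    (*-congˡ (det-cong {A = δ ⊗ B} {B} λ i l → sum-δˡ i (λ k → B k l)))
    where
    ⊗-alternating : Alternating λ A → det (A ⊗ B)
    ⊗-alternating = record
      { multilinear = record
        { cong   = λ A≈A′ → det-cong λ i l → sum-cong-≋ λ k → *-congʳ (A≈A′ i k)
        ; linear = λ i x row C≈A C≈A′ → det-linear i x
            (λ l → sum-linear x λ k → trans (*-congʳ (row k))
              (solve 4 (λ x a b m → (x :* a :+ b) :* m := x :* (a :* m) :+ b :* m) refl x _ _ _))
            (λ k k≢i l → sum-cong-≋ λ j → *-congʳ (C≈A k k≢i j))
            (λ k k≢i l → sum-cong-≋ λ j → *-congʳ (C≈A′ k k≢i j))
        }
      ; vanishes = λ i≢j Ai≈Aj → det-vanishes i≢j λ l → sum-cong-≋ λ k → *-congʳ (Ai≈Aj k)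
      }

  diagonal : (Fin n → Carrier) → Matrix n n
  diagonal d i j = d i * δ i j

  det-diagonal : ∀ (d : Fin n → Carrier) → det (diagonal d) ≈ product d
  det-diagonal {zero}  d = refl
  det-diagonal {suc n} d = begin
    1# * ((d zero * 1#) * det (diagonal (d ∘ suc))) + sum rest
      ≈⟨ +-cong (trans (*-identityˡ _) (*-cong (*-identityʳ _) (det-diagonal (d ∘ suc))))
           (sum-zero {f = rest} λ j →
             trans (*-congˡ (trans (*-congʳ (zeroʳ (d zero))) (zeroˡ _))) (zeroʳ _)) ⟩
    product d + 0#
      ≈⟨ +-identityʳ _ ⟩
    product d ∎
    where
    rest : Fin n → Carrier
    rest j = (- 1#) ^ suc (toℕ j) * ((d zero * 0#) * det (minor (diagonal d) zero (suc j)))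

  -- Linearity above concerns rows; scaling columns is instead right multiplication by a diagonal
  -- matrix.
  det-scale-columns : ∀ (A : Matrix n n) (d : Fin n → Carrier) →
                      det (λ i j → A i j * d j) ≈ det A * product d
  det-scale-columns A d = begin
    det (λ i j → A i j * d j)   ≈⟨ det-cong (λ i j → entry i j) ⟨
    det (A ⊗ diagonal d)        ≈⟨ det-⊗ A (diagonal d) ⟩
    det A * det (diagonal d)    ≈⟨ *-congˡ (det-diagonal d) ⟩
    det A * product d           ∎
    where
    entry : ∀ i j → (A ⊗ diagonal d) i j ≈ A i j * d j
    entry i j = trans
      (sum-cong (λ k → A i k * (d k * δ k j)) (λ k → (A i k * d k) * δ k j)
        (λ k → sym (*-assoc (A i k) (d k) (δ k j))))
      (sum-δʳ j (λ k → A i k * d k))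

  δ-diagonal : ∀ (i : Fin n) → δ i i ≡ 1#
  δ-diagonal zero    = ≡.refl
  δ-diagonal (suc i) = δ-diagonal i

  δ-off-diagonal : ∀ {i j : Fin n} → i ≢ j → δ i j ≡ 0#
  δ-off-diagonal {i = zero}  {zero}  i≢j = contradiction ≡.refl i≢j
  δ-off-diagonal {i = zero}  {suc j} i≢j = ≡.refl
  δ-off-diagonal {i = suc i} {zero}  i≢j = ≡.refl
  δ-off-diagonal {i = suc i} {suc j} i≢j = δ-off-diagonal (i≢j ∘ ≡.cong suc)

-- The field of residues modulo p

module Modular (q : ℕ) (p-prime : Prime (suc q)) where

  open +-*-Solver

  p : ℕ
  p = suc q

  infix 4 _≈_ _≉_
  -- Wrapping the divisibility in a record lets `a` and `b` be inferred from a proof, which the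
  -- difference alone would not permit.
  record _≈_ (a b : ℤ) : Set where
    constructor congruent
    field
      p∣a-b : + p ℤ.∣ a ℤ.- b

  _≉_ : ℤ → ℤ → Set
  a ≉ b = ¬ a ≈ b

  multiple : ∀ {a b} k → a ℤ.- b ≡ k ℤ.* + p → a ≈ b
  multiple k eq = congruent (divides k eq)

  ≈-reflexive : ∀ {a b} → a ≡ b → a ≈ b
  ≈-reflexive {a} ≡.refl = multiple 0ℤ (ℤ.+-inverseʳ a)

  ℤ/p : CommutativeRing 0ℓ 0ℓ
  ℤ/p = record
    { Carrier = ℤ ; _≈_ = _≈_ ; _+_ = ℤ._+_ ; _*_ = ℤ._*_ ; -_ = ℤ.-_ ; 0# = 0ℤ ; 1# = 1ℤ
    ; isCommutativeRing = record
      { isRing = record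
        { +-isAbelianGroup = record
          { isGroup = record
            { isMonoid = record
              { isSemigroup = record
                { isMagma = record
                  { isEquivalence = record
                    { refl = ≈-reflexive ≡.refl ; sym = ≈-sym ; trans = ≈-trans }
                  ; ∙-cong = +-cong }
                ; assoc = λ a b c → ≈-reflexive (ℤ.+-assoc a b c) }
              ; identity = (λ a → ≈-reflexive (ℤ.+-identityˡ a))
                         , (λ a → ≈-reflexive (ℤ.+-identityʳ a)) }
            ; inverse = (λ a → ≈-reflexive (ℤ.+-inverseˡ a))
                      , (λ a → ≈-reflexive (ℤ.+-inverseʳ a))
            ; ⁻¹-cong = -‿cong }
          ; comm = λ a b → ≈-reflexive (ℤ.+-comm a b) }
        ; *-cong = *-cong
        ; *-assoc = λ a b c → ≈-reflexive (ℤ.*-assoc a b c)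
        ; *-identity = (λ a → ≈-reflexive (ℤ.*-identityˡ a))
                     , (λ a → ≈-reflexive (ℤ.*-identityʳ a))
        ; distrib = (λ a b c → ≈-reflexive (ℤ.*-distribˡ-+ a b c))
                  , (λ a b c → ≈-reflexive (ℤ.*-distribʳ-+ a b c)) }
      ; *-comm = λ a b → ≈-reflexive (ℤ.*-comm a b) } }
    where
    ≈-sym : ∀ {a b} → a ≈ b → b ≈ a
    ≈-sym {a} {b} (congruent a-b) = congruent (≡.subst (+ p ℤ.∣_)
      (solve 2 (λ a b → :- (a :- b) := b :- a) ≡.refl a b) (ℤ.∣m⇒∣-m a-b))

    ≈-trans : ∀ {a b c} → a ≈ b → b ≈ c → a ≈ c
    ≈-trans {a} {b} {c} (congruent a-b) (congruent b-c) = congruent (≡.subst (+ p ℤ.∣_)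
      (solve 3 (λ a b c → (a :- b) :+ (b :- c) := a :- c) ≡.refl a b c) (ℤ.∣m∣n⇒∣m+n a-b b-c))

    +-cong : ∀ {a a′ b b′} → a ≈ a′ → b ≈ b′ → a ℤ.+ b ≈ a′ ℤ.+ b′
    +-cong {a} {a′} {b} {b′} (congruent a-a′) (congruent b-b′) = congruent (≡.subst (+ p ℤ.∣_)
      (solve 4 (λ a a′ b b′ → (a :- a′) :+ (b :- b′) := (a :+ b) :- (a′ :+ b′)) ≡.refl a a′ b b′)
      (ℤ.∣m∣n⇒∣m+n a-a′ b-b′))

    *-cong : ∀ {a a′ b b′} → a ≈ a′ → b ≈ b′ → a ℤ.* b ≈ a′ ℤ.* b′
    *-cong {a} {a′} {b} {b′} (congruent a-a′) (congruent b-b′) = congruent (≡.subst (+ p ℤ.∣_)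
      (solve 4 (λ a a′ b b′ → (a :- a′) :* b :+ a′ :* (b :- b′) := a :* b :- a′ :* b′)
        ≡.refl a a′ b b′)
      (ℤ.∣m∣n⇒∣m+n (ℤ.∣m⇒∣m*n b a-a′) (ℤ.∣n⇒∣m*n a′ b-b′)))

    -‿cong : ∀ {a b} → a ≈ b → ℤ.- a ≈ ℤ.- b
    -‿cong {a} {b} (congruent a-b) = congruent (≡.subst (+ p ℤ.∣_)
      (solve 2 (λ a b → :- (a :- b) := :- a :- (:- b)) ≡.refl a b) (ℤ.∣m⇒∣-m a-b))

  open CommutativeRing ℤ/p public
    using (rawRing; setoid; refl; sym; trans; +-cong; +-congˡ; +-congʳ; -‿cong;
           *-cong; *-congˡ; *-congʳ; _+_; _*_; -_; _-_; semiring;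
           commutativeSemiring; *-commutativeMonoid)
  open import Algebra.Properties.CommutativeSemiring.Exp commutativeSemiring public
    using (_^_; ^-congˡ; ^-homo-*; ^-assocʳ; ^-distrib-*)
  open import Algebra.Properties.Semiring.Sum semiring public
    using (sum; sum-init-last; sum-replicate; *-distribˡ-sum; *-distribʳ-sum)
  open import Algebra.Properties.Semiring.Mult semiring public using () renaming (_×_ to _·_)
  open import Algebra.Properties.CommutativeMonoid.Sum *-commutativeMonoid public
    using () renaming (sum to product; ∑-distrib-+ to product-*; sum-replicate to product-replicate)
  open DeterminantProperties ℤ/p public
  open import Relation.Binary.Reasoning.Setoid setoid

  _≈?_ : ∀ a b → Dec (a ≈ b)
  a ≈? b = map′ congruent _≈_.p∣a-b (+ p ℤ.∣? (a ℤ.- b))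

  ≈0⇒∣ : ∀ {a} → a ≈ 0ℤ → p ℕ.∣ ℤ.∣ a ∣
  ≈0⇒∣ {a} (congruent a-0) = ℤ.∣⇒∣ᵤ (≡.subst (+ p ℤ.∣_) (ℤ.+-identityʳ a) a-0)

  ∣⇒≈0 : ∀ {a} → p ℕ.∣ ℤ.∣ a ∣ → a ≈ 0ℤ
  ∣⇒≈0 {a} p∣a = congruent (≡.subst (+ p ℤ.∣_) (≡.sym (ℤ.+-identityʳ a)) (ℤ.∣ᵤ⇒∣ {+ p} {a} p∣a))

  difference≈0 : ∀ {a b} → a - b ≈ 0ℤ → a ≈ b
  difference≈0 {a} {b} (congruent d) = congruent (≡.subst (+ p ℤ.∣_) (ℤ.+-identityʳ (a - b)) d)

  zero-product : ∀ a b → a * b ≈ 0ℤ → a ≈ 0ℤ ⊎ b ≈ 0ℤ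
  zero-product a b ab≈0 = Sum.map ∣⇒≈0 ∣⇒≈0
    (euclidsLemma ℤ.∣ a ∣ ℤ.∣ b ∣ p-prime (≡.subst (p ℕ.∣_) (ℤ.abs-* a b) (≈0⇒∣ ab≈0)))

  1≉0 : 1ℤ ≉ 0ℤ
  1≉0 1≈0 = ℕ.nonTrivial⇒≢1 {{prime⇒nonTrivial p-prime}} (ℕ.∣1⇒≡1 (≈0⇒∣ 1≈0))

  *-cancelˡ-≈ : ∀ {a b c} → a ≉ 0ℤ → a * b ≈ a * c → b ≈ c
  *-cancelˡ-≈ {a} {b} {c} a≉0 ab≈ac =
    [ (λ a≈0 → contradiction a≈0 a≉0) , difference≈0 ]′ (zero-product a (b - c) (begin
      a * (b - c)      ≡⟨ solve 3 (λ a b c → a :* (b :- c) := a :* b :- a :* c) ≡.refl a b c ⟩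
      a * b - a * c    ≈⟨ +-congʳ {ℤ.- (a * c)} ab≈ac ⟩
      a * c - a * c    ≡⟨ ℤ.+-inverseʳ (a * c) ⟩
      0ℤ               ∎))

  positive≉0 : ∀ {n} → n ℕ.< q → +[1+ n ] ≉ 0ℤ
  positive≉0 n<q n≈0 = ℕ.<⇒≱ (ℕ.s≤s n<q) (ℕ.∣⇒≤ (≈0⇒∣ n≈0))

  ≈⇒≡ : ∀ {a b} → a ℕ.< p → b ℕ.< p → + a ≈ + b → a ≡ b
  ≈⇒≡ {a} {b} a<p b<p a≈b = [ le a<p b<p a≈b , (λ b≤a → ≡.sym (le b<p a<p (sym a≈b) b≤a)) ]′
                                (ℕ.≤-total a b)
    where
    le : ∀ {a b} → a ℕ.< p → b ℕ.< p → + a ≈ + b → a ℕ.≤ b → a ≡ b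
    le {a} {b} a<p b<p a≈b a≤b = step (b ℕ.∸ a) ≡.refl (begin
      + (b ℕ.∸ a)  ≡⟨ ℤ.⊖-≥ a≤b ⟨
      b ℤ.⊖ a      ≡⟨ ℤ.m-n≡m⊖n b a ⟨
      + b - + a    ≈⟨ +-congʳ {ℤ.- (+ a)} (sym a≈b) ⟩
      + a - + a    ≡⟨ ℤ.+-inverseʳ (+ a) ⟩
      0ℤ           ∎)
      where
      step : ∀ d → b ℕ.∸ a ≡ d → + d ≈ 0ℤ → a ≡ b
      step zero    eq _    = ℕ.≤-antisym a≤b (ℕ.m∸n≡0⇒m≤n eq)
      step (suc d) eq sd≈0 = contradiction sd≈0 (positive≉0
        (ℕ.≤-pred (ℕ.≤-<-trans (≡.subst (ℕ._≤ b) eq (ℕ.m∸n≤m b a)) b<p)))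

  -- Fermat's little theorem and geometric sums

  p∤k! : ∀ {k} → k ℕ.< p → ¬ p ℕ.∣ k !
  p∤k! {zero}  _    p∣1 = ℕ.nonTrivial⇒≢1 {{prime⇒nonTrivial p-prime}} (ℕ.∣1⇒≡1 p∣1)
  p∤k! {suc k} k<p p∣k! =
    [ (λ p∣sk → ℕ.<⇒≱ k<p (ℕ.∣⇒≤ p∣sk)) , p∤k! (ℕ.<-trans (ℕ.n<1+n k) k<p) ]′
      (euclidsLemma (suc k) (k !) p-prime p∣k!)

  -- The prime divides p! = C(p, k) · k! · (p - k)! but neither of the two factorials on the right.
  p∣pCk : ∀ {k} → 0 ℕ.< k → k ℕ.< p → p ℕ.∣ p choose k
  p∣pCk {k} 0<k k<p =
    [ (λ p∣pCk → p∣pCk)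
    , (λ p∣ → contradiction (euclidsLemma (k !) ((p ℕ.∸ k) !) p-prime p∣)
        [ p∤k! k<p , p∤k! (ℕ.∸-monoʳ-< 0<k (ℕ.<⇒≤ k<p)) ]′)
    ]′ (euclidsLemma (p choose k) (k ! ℕ.* (p ℕ.∸ k) !) p-prime
         (≡.subst (p ℕ.∣_) (≡.sym pCk*≡p!) (ℕ.m∣m*n (q !))))
    where
    instance _ = k ℕ.!* (p ℕ.∸ k) !≢0
    pCk*≡p! : (p choose k) ℕ.* (k ! ℕ.* (p ℕ.∸ k) !) ≡ p !
    pCk*≡p! = ≡.trans (≡.cong (ℕ._* (k ! ℕ.* (p ℕ.∸ k) !)) (nCk≡n!/k![n-k]! (ℕ.<⇒≤ k<p)))
                      (ℕ.m/n*n≡m (k![n∸k]!∣n! (ℕ.<⇒≤ k<p)))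

  ·≡* : ∀ n a → n · a ≡ + n * a
  ·≡* zero    a = ≡.sym (ℤ.*-zeroˡ a)
  ·≡* (suc n) a = ≡.trans (≡.cong (λ b → a + b) (·≡* n a))
    (solve 2 (λ n a → a :+ n :* a := (con 1ℤ :+ n) :* a) ≡.refl (+ n) a)

  1^n≈1 : ∀ n → 1ℤ ^ n ≈ 1ℤ
  1^n≈1 zero    = refl
  1^n≈1 (suc n) = trans (≈-reflexive (ℤ.*-identityˡ _)) (1^n≈1 n)

  -- All inner binomial coefficients vanish modulo p. One summand is 1 because this is the step of
  -- the induction in `fermat`.
  frobenius : ∀ a → (a + 1ℤ) ^ p ≈ a ^ p + 1ℤ
  frobenius a = begin
    (a + 1ℤ) ^ p
      ≈⟨ theorem p a 1ℤ ⟩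
    t zero + sum (t ∘ suc)
      ≈⟨ +-congˡ {t zero} (sum-init-last (t ∘ suc)) ⟩
    t zero + (sum (λ i → t (suc (inject₁ i))) + t (fromℕ p))
      ≈⟨ +-cong first (+-cong (sum-zero {f = λ i → t (suc (inject₁ i))} middle) last) ⟩
    1ℤ + (0ℤ + a ^ p)
      ≡⟨ solve 1 (λ x → con 1ℤ :+ (con 0ℤ :+ x) := x :+ con 1ℤ) ≡.refl (a ^ p) ⟩
    a ^ p + 1ℤ ∎
    where
    open import Algebra.Properties.CommutativeSemiring.Binomial commutativeSemiring using (theorem)

    t : Fin (suc p) → ℤ
    t k = (p choose toℕ k) · (a ^ toℕ k * 1ℤ ^ (p ℕ.∸ toℕ k))

    first : t zero ≈ 1ℤ
    first = begin
      1ℤ * 1ℤ ^ p + 0ℤ  ≡⟨ solve 1 (λ x → con 1ℤ :* x :+ con 0ℤ := x) ≡.refl (1ℤ ^ p) ⟩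
      1ℤ ^ p            ≈⟨ 1^n≈1 p ⟩
      1ℤ                ∎

    middle : ∀ i → t (suc (inject₁ i)) ≈ 0ℤ
    middle i = begin
      c · b        ≡⟨ ·≡* c b ⟩
      + c * b      ≈⟨ *-congʳ {b} (∣⇒≈0 {+ c} (p∣pCk (ℕ.s≤s ℕ.z≤n)
        (ℕ.s≤s (≡.subst (ℕ._< q) (≡.sym (Fin.toℕ-inject₁ i)) (Fin.toℕ<n i))))) ⟩
      0ℤ * b       ≡⟨ ℤ.*-zeroˡ b ⟩
      0ℤ           ∎
      where
      k c : ℕ
      k = suc (toℕ (inject₁ i))
      c = p choose k
      b : ℤ
      b = a ^ k * 1ℤ ^ (p ℕ.∸ k)

    last : t (fromℕ p) ≈ a ^ p
    last = begin
      t (fromℕ p)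
        ≡⟨ ≡.cong (λ k → (p choose k) · (a ^ k * 1ℤ ^ (p ℕ.∸ k))) (Fin.toℕ-fromℕ p) ⟩
      (p choose p) · (a ^ p * 1ℤ ^ (p ℕ.∸ p))
        ≡⟨ ≡.cong₂ (λ c e → c · (a ^ p * 1ℤ ^ e)) (nCn≡1 p) (ℕ.n∸n≡0 p) ⟩
      a ^ p * 1ℤ + 0ℤ
        ≡⟨ solve 1 (λ x → x :* con 1ℤ :+ con 0ℤ := x) ≡.refl (a ^ p) ⟩
      a ^ p ∎

  fermat : ∀ n → (+ n) ^ p ≈ + n
  fermat zero    = ≈-reflexive (ℤ.*-zeroˡ (0ℤ ^ q))
  fermat (suc n) = begin
    +[1+ n ] ^ p       ≡⟨ ≡.cong (_^ p) (ℤ.+-comm 1ℤ (+ n)) ⟩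
    (+ n + 1ℤ) ^ p     ≈⟨ frobenius (+ n) ⟩
    (+ n) ^ p + 1ℤ     ≈⟨ +-congʳ {1ℤ} (fermat n) ⟩
    + n + 1ℤ           ≡⟨ ℤ.+-comm (+ n) 1ℤ ⟩
    +[1+ n ]           ∎

  fermat-unit : ∀ n → + n ≉ 0ℤ → (+ n) ^ q ≈ 1ℤ
  fermat-unit n n≉0 = *-cancelˡ-≈ n≉0
    (trans (fermat n) (≈-reflexive (≡.sym (ℤ.*-identityʳ (+ n)))))

  geometric : ∀ r n → (r - 1ℤ) * sum {n} (λ k → r ^ toℕ k) ≈ r ^ n - 1ℤ
  geometric r zero    = ≈-reflexive (ℤ.*-zeroʳ (r - 1ℤ))
  geometric r (suc n) = begin
    (r - 1ℤ) * (1ℤ + sum {n} (λ k → r * r ^ toℕ k))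
      ≈⟨ *-congˡ {r - 1ℤ} (+-congˡ {1ℤ} (*-distribˡ-sum {n} r (λ k → r ^ toℕ k))) ⟨
    (r - 1ℤ) * (1ℤ + r * s)
      ≡⟨ solve 2 (λ r s → (r :- con 1ℤ) :* (con 1ℤ :+ r :* s) :=
                          (r :- con 1ℤ) :+ r :* ((r :- con 1ℤ) :* s)) ≡.refl r s ⟩
    (r - 1ℤ) + r * ((r - 1ℤ) * s)
      ≈⟨ +-congˡ {r - 1ℤ} (*-congˡ {r} (geometric r n)) ⟩
    (r - 1ℤ) + r * (r ^ n - 1ℤ)
      ≡⟨ solve 2 (λ r z → (r :- con 1ℤ) :+ r :* (z :- con 1ℤ) := r :* z :- con 1ℤ) ≡.refl r (r ^ n) ⟩
    r ^ suc n - 1ℤ ∎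
    where s = sum {n} (λ k → r ^ toℕ k)

  -- As p is prime, a nonzero root amounts to a nonzero `a`; in this form products of squares only
  -- require products of roots.
  record NonZeroSquare (a : ℤ) : Set where
    constructor square
    field
      root   : ℤ
      root≉0 : root ≉ 0ℤ
      root²  : root * root ≈ a

  *-nonZero : ∀ {a b} → a ≉ 0ℤ → b ≉ 0ℤ → a * b ≉ 0ℤ
  *-nonZero {a} {b} a≉0 b≉0 ab≈0 = [ a≉0 , b≉0 ]′ (zero-product a b ab≈0)

  ^-nonZero : ∀ {a} n → a ≉ 0ℤ → a ^ n ≉ 0ℤ
  ^-nonZero     zero    a≉0 = 1≉0
  ^-nonZero {a} (suc n) a≉0 = *-nonZero {a} a≉0 (^-nonZero n a≉0)

  product-nonZero : ∀ {n} {f : Fin n → ℤ} → (∀ i → f i ≉ 0ℤ) → product f ≉ 0ℤ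
  product-nonZero {zero}      f≉0 = 1≉0
  product-nonZero {suc n} {f} f≉0 = *-nonZero {f zero} (f≉0 zero) (product-nonZero (λ i → f≉0 (suc i)))

  square-cong : ∀ {a b} → a ≈ b → NonZeroSquare a → NonZeroSquare b
  square-cong a≈b (square y y≉0 y²) = square y y≉0 (trans y² a≈b)

  square-* : ∀ {a b} → NonZeroSquare a → NonZeroSquare b → NonZeroSquare (a * b)
  square-* {a} {b} (square y y≉0 y²) (square z z≉0 z²) = square (y * z) (*-nonZero {y} y≉0 z≉0) (begin
    (y * z) * (y * z)  ≡⟨ solve 2 (λ y z → (y :* z) :* (y :* z) := (y :* y) :* (z :* z)) ≡.refl y z ⟩
    (y * y) * (z * z)  ≈⟨ *-cong y² z² ⟩
    a * b              ∎)

  square-^ : ∀ {a} n → NonZeroSquare a → NonZeroSquare (a ^ n)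
  square-^ zero    _  = square 1ℤ 1≉0 refl
  square-^ (suc n) a² = square-* a² (square-^ n a²)

  square-self : ∀ {a} → a ≉ 0ℤ → NonZeroSquare (a * a)
  square-self {a} a≉0 = square a a≉0 refl

  square-^-even : ∀ {a} k → a ≉ 0ℤ → NonZeroSquare (a ^ (k ℕ.+ k))
  square-^-even {a} k a≉0 = square-cong (sym (^-homo-* a k k)) (square-self (^-nonZero k a≉0))

  -1≉0 : -1ℤ ≉ 0ℤ
  -1≉0 -1≈0 = 1≉0 (-‿cong -1≈0)

-- Matrices of powers of the nonzero residues

module UnitMatrices (q : ℕ) (p-prime : Prime (suc q)) where

  open Modular q p-prime
  open Determinant rawRing using (Matrix; det)
  open import Relation.Binary.Reasoning.Setoid setoid
  open +-*-Solver

  -- By Fermat the inverse of `x i` is its power with exponent p - 2.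
  x u : Fin q → ℤ
  x i = +[1+ toℕ i ]
  u i = x i ^ ℕ.pred q

  x≉0 : ∀ i → x i ≉ 0ℤ
  x≉0 i = positive≉0 (Fin.toℕ<n i)

  x^q≈1 : ∀ i → x i ^ q ≈ 1ℤ
  x^q≈1 i = fermat-unit (suc (toℕ i)) (x≉0 i)

  x*u≈1 : ∀ i → x i * u i ≈ 1ℤ
  x*u≈1 i = trans (≈-reflexive (≡.cong (λ n → x i ^ n)
    (ℕ.suc-pred q {{ℕ.>-nonZero (ℕ.≤-<-trans ℕ.z≤n (Fin.toℕ<n i))}}))) (x^q≈1 i)

  u≉0 : ∀ i → u i ≉ 0ℤ
  u≉0 i = ^-nonZero (ℕ.pred q) (x≉0 i)

  u^k≈1 : ∀ i k → x i ^ k ≈ 1ℤ → u i ^ k ≈ 1ℤ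
  u^k≈1 i k x^k≈1 = begin
    (x i ^ d) ^ k     ≈⟨ ^-assocʳ (x i) d k ⟩
    x i ^ (d ℕ.* k)   ≡⟨ ≡.cong (λ n → x i ^ n) (ℕ.*-comm d k) ⟩
    x i ^ (k ℕ.* d)   ≈⟨ ^-assocʳ (x i) k d ⟨
    (x i ^ k) ^ d     ≈⟨ ^-congˡ d x^k≈1 ⟩
    1ℤ ^ d            ≈⟨ 1^n≈1 d ⟩
    1ℤ                ∎
    where d = ℕ.pred q

  ratio^q≈1 : ∀ i j → (x i * u j) ^ q ≈ 1ℤ
  ratio^q≈1 i j = begin
    (x i * u j) ^ q     ≈⟨ ^-distrib-* (x i) (u j) q ⟩
    x i ^ q * u j ^ q   ≈⟨ *-cong (x^q≈1 i) (u^k≈1 j q (x^q≈1 j)) ⟩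
    1ℤ                  ∎

  ratio≈1 : ∀ {i j} → x i * u j ≈ 1ℤ → i ≡ j
  ratio≈1 {i} {j} r≈1 = Fin.toℕ-injective (ℕ.suc-injective
    (≈⇒≡ (ℕ.s≤s (Fin.toℕ<n i)) (ℕ.s≤s (Fin.toℕ<n j)) (begin
      x i                  ≡⟨ ℤ.*-identityʳ (x i) ⟨
      x i * 1ℤ             ≈⟨ *-congˡ {x i} (x*u≈1 j) ⟨
      x i * (x j * u j)    ≡⟨ solve 3 (λ a b c → a :* (b :* c) := b :* (a :* c))
                                ≡.refl (x i) (x j) (u j) ⟩
      x j * (x i * u j)    ≈⟨ *-congˡ {x j} r≈1 ⟩
      x j * 1ℤ             ≡⟨ ℤ.*-identityʳ (x j) ⟩
      x j                  ∎)))

  V W : Matrix q q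
  V i k = x i ^ toℕ k
  W k j = u j ^ toℕ k

  V⊗W : ∀ i j → (V ⊗ W) i j ≈ diagonal (λ _ → -1ℤ) i j
  V⊗W i j = trans
    (sum-cong {q} (λ k → V i k * W k j) (λ k → r ^ toℕ k) (λ k → sym (^-distrib-* (x i) (u j) (toℕ k))))
    (powers (i Fin.≟ j))
    where
    r = x i * u j
    s = sum {q} λ k → r ^ toℕ k

    powers : Dec (i ≡ j) → s ≈ -1ℤ * δ i j
    powers (yes ≡.refl) = begin
      s                        ≈⟨ sum-cong {q} (λ k → r ^ toℕ k) (λ _ → 1ℤ) (λ k →
                                    trans (^-congˡ (toℕ k) (x*u≈1 i)) (1^n≈1 (toℕ k))) ⟩
      sum {q} (λ _ → 1ℤ)       ≈⟨ sum-replicate q ⟩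
      q · 1ℤ                   ≡⟨ ·≡* q 1ℤ ⟩
      + q * 1ℤ                 ≈⟨ multiple 1ℤ (solve 1 (λ n → n :* con 1ℤ :- con -1ℤ :=
                                    con 1ℤ :* (con 1ℤ :+ n)) ≡.refl (+ q)) ⟩
      -1ℤ                      ≡⟨ ≡.cong (λ d → -1ℤ * d) (δ-diagonal i) ⟨
      -1ℤ * δ i i              ∎
    powers (no i≢j) = begin
      s               ≈⟨ [ (λ r-1≈0 → contradiction (ratio≈1 {i} {j} (difference≈0 r-1≈0)) i≢j)
                         , (λ s≈0 → s≈0) ]′
                           (zero-product (r - 1ℤ) s (begin
                             (r - 1ℤ) * s   ≈⟨ geometric r q ⟩
                             r ^ q - 1ℤ     ≈⟨ +-congʳ { -1ℤ} (ratio^q≈1 i j) ⟩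
                             0ℤ             ∎)) ⟩
      0ℤ              ≡⟨ ≡.cong (λ d → -1ℤ * d) (δ-off-diagonal i≢j) ⟨
      -1ℤ * δ i j     ∎

  det-V*det-W : det V * det W ≈ product {q} (λ _ → -1ℤ)
  det-V*det-W = begin
    det V * det W                    ≈⟨ det-⊗ V W ⟨
    det (V ⊗ W)                      ≈⟨ det-cong V⊗W ⟩
    det (diagonal {q} (λ _ → -1ℤ))   ≈⟨ det-diagonal {q} (λ _ → -1ℤ) ⟩
    product {q} (λ _ → -1ℤ)          ∎

  -- Powers with exponent (p - 1)/2 and a square root of -1

  module _ (half : ℕ) (q≡half+half : q ≡ half ℕ.+ half) where

    square-^q : ∀ {a} → a ≉ 0ℤ → NonZeroSquare (a ^ q)
    square-^q {a} a≉0 = ≡.subst (λ n → NonZeroSquare (a ^ n)) (≡.sym q≡half+half)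
      (square-^-even half a≉0)

    -- If every half-th power were 1, two rows of W would agree modulo p.
    half-power : ∃ λ i → x i ^ half ≉ 1ℤ
    half-power = Fin.¬∀⟶∃¬ q (λ i → x i ^ half ≈ 1ℤ) (λ i → (x i ^ half) ≈? 1ℤ) λ x^half≈1 →
      product-nonZero {q} {λ _ → -1ℤ} (λ _ → -1≉0) (begin
        product {q} (λ _ → -1ℤ)   ≈⟨ det-V*det-W ⟨
        det V * det W             ≈⟨ *-congˡ {det V} (det-vanishes
            {i = row0} {row} row0≢row {W} (λ j → begin
          u j ^ toℕ row0     ≡⟨ ≡.cong (λ n → u j ^ n) (Fin.toℕ-fromℕ< 0<q) ⟩
          1ℤ                 ≈⟨ u^k≈1 j half (x^half≈1 j) ⟨
          u j ^ half         ≡⟨ ≡.cong (λ n → u j ^ n) (Fin.toℕ-fromℕ< half<q) ⟨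
          u j ^ toℕ row      ∎)) ⟩
        det V * 0ℤ                ≡⟨ ℤ.*-zeroʳ (det V) ⟩
        0ℤ                        ∎)
      where
      0<q : 0 ℕ.< q
      0<q = ℕ.≤-pred (ℕ.nonTrivial⇒n>1 (suc q) {{prime⇒nonTrivial p-prime}})
      0<half : ∀ h → q ≡ h ℕ.+ h → 0 ℕ.< h
      0<half zero    q≡0 = contradiction (≡.sym q≡0) (ℕ.<⇒≢ 0<q)
      0<half (suc h) _   = ℕ.s≤s ℕ.z≤n
      half<q : half ℕ.< q
      half<q = ≡.subst (half ℕ.<_) (≡.sym q≡half+half) (ℕ.m<m+n half (0<half half q≡half+half))
      row0 row : Fin q
      row0 = fromℕ< 0<q
      row = fromℕ< half<q
      row0≢row : row0 ≢ row
      row0≢row eq = ℕ.<⇒≢ (0<half half q≡half+half) (≡.trans (≡.sym (Fin.toℕ-fromℕ< 0<q))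
        (≡.trans (≡.cong toℕ eq) (Fin.toℕ-fromℕ< half<q)))

    -- By Fermat every half-th power has square 1, and the one from `half-power` is not 1.
    half-power≈-1 : ∃ λ i → x i ^ half ≈ -1ℤ
    half-power≈-1 = i , [ (λ y-1≈0 → contradiction (difference≈0 y-1≈0) y≉1)
                        , difference≈0 {b = -1ℤ} ]′
      (zero-product (y - 1ℤ) (y - -1ℤ) (begin
        (y - 1ℤ) * (y - -1ℤ)   ≡⟨ solve 1 (λ y → (y :- con 1ℤ) :* (y :- con -1ℤ) :=
                                      y :* y :- con 1ℤ) ≡.refl y ⟩
        y * y - 1ℤ             ≈⟨ +-congʳ { -1ℤ} (begin
          y * y                  ≈⟨ ^-homo-* (x i) half half ⟨
          x i ^ (half ℕ.+ half)  ≡⟨ ≡.cong (λ n → x i ^ n) q≡half+half ⟨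
          x i ^ q                ≈⟨ x^q≈1 i ⟩
          1ℤ                     ∎) ⟩
        0ℤ                     ∎))
      where
      i = proj₁ half-power
      y≉1 = proj₂ half-power
      y = x i ^ half

    square-[-1] : ∀ quarter → half ≡ quarter ℕ.+ quarter → NonZeroSquare -1ℤ
    square-[-1] quarter half≡ = square s s≉0 s²≈-1
      where
      i = proj₁ half-power≈-1
      s = x i ^ quarter

      s≉0 : s ≉ 0ℤ
      s≉0 = ^-nonZero quarter (x≉0 i)

      s²≈-1 : s * s ≈ -1ℤ
      s²≈-1 = begin
        s * s                        ≈⟨ ^-homo-* (x i) quarter quarter ⟨
        x i ^ (quarter ℕ.+ quarter)  ≡⟨ ≡.cong (λ n → x i ^ n) half≡ ⟨
        x i ^ half                   ≈⟨ proj₂ half-power≈-1 ⟩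
        -1ℤ                          ∎

    -- The factorisation of the matrix modulo p

    module _ (c : Fin q → ℤ) (t : ℤ) (t≉0 : t ≉ 0ℤ)
      (inverse : ∀ r → r ^ q ≈ 1ℤ → (r * r - r + 1ℤ) * sum (λ k → c k * r ^ toℕ k) * t ≈ 1ℤ)
      where

      -- The square u_j² comes from 1/(i² - ij + j²) = u_j² / (r² - r + 1). The constant `t`, later
      -- the inverse of 3, is kept out of the coefficients `c`; over the q columns it contributes
      -- `t ^ q`, a square because q is even.
      columns : Fin q → ℤ
      columns j = t * (u j * u j)

      S : Matrix q q
      S i j = ((λ i k → V i k * c k) ⊗ W) i j * columns j

      det-S : det S ≈ det V * product c * det W * product columns
      det-S = begin
        det S
          ≈⟨ det-scale-columns ((λ i k → V i k * c k) ⊗ W) columns ⟩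
        det ((λ i k → V i k * c k) ⊗ W) * product columns
          ≈⟨ *-congʳ {product columns} (det-⊗ (λ i k → V i k * c k) W) ⟩
        det (λ i k → V i k * c k) * det W * product columns
          ≈⟨ *-congʳ {product columns} (*-congʳ {det W} (det-scale-columns V c)) ⟩
        det V * product c * det W * product columns ∎

      square-2*det-S : NonZeroSquare (+ 2 * product c) → NonZeroSquare (+ 2 * det S)
      square-2*det-S 2Πc = square-cong (begin
          + 2 * product c * (product {q} (λ _ → -1ℤ) * product columns)
            ≈⟨ *-congˡ {+ 2 * product c} (*-congʳ {product columns} det-V*det-W) ⟨
          + 2 * product c * (det V * det W * product columns)
            ≡⟨ solve 5 (λ a b v w e → a :* b :* (v :* w :* e) := a :* (v :* b :* w :* e))
                 ≡.refl (+ 2) (product c) (det V) (det W) (product columns) ⟩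
          + 2 * (det V * product c * det W * product columns)
            ≈⟨ *-congˡ {+ 2} det-S ⟨
          + 2 * det S ∎)
        (square-* 2Πc (square-* Π-1 Πcolumns))
        where
        Π-1 : NonZeroSquare (product {q} (λ _ → -1ℤ))
        Π-1 = square-cong (sym (product-replicate q)) (square-^q -1≉0)
        Πcolumns : NonZeroSquare (product columns)
        Πcolumns = square-cong (begin
            t ^ q * (product u * product u)
              ≈⟨ *-cong (product-replicate q {t}) (product-* u u) ⟨
            product {q} (λ _ → t) * product (λ j → u j * u j)
              ≈⟨ product-* (λ _ → t) (λ j → u j * u j) ⟨
            product columns ∎)
          (square-* (square-^q t≉0) (square-self (product-nonZero {f = u} u≉0)))

      -- Multiplication by u_j² turns the form into r² - r + 1 at r = x_i u_j, where `inverse`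
      -- applies. This identifies `S i j` as the residue of the corresponding entry of T_p.
      form*S≈1 : ∀ i j → form (x i) (x j) * S i j ≈ 1ℤ
      form*S≈1 i j = begin
        form a b * (G * (t * (v * v)))
          ≈⟨ *-congˡ {form a b} (*-congʳ {t * (v * v)} series≈) ⟩
        form a b * (g * (t * (v * v)))
          ≡⟨ solve 5 (λ a b v t g →
               (a :* a :- a :* b :+ b :* b) :* (g :* (t :* (v :* v))) :=
               (a :* v :* (a :* v) :- a :* v :* (b :* v) :+ b :* v :* (b :* v)) :* g :* t)
               ≡.refl a b v t g ⟩
        (r * r - r * (b * v) + b * v * (b * v)) * g * t
          ≈⟨ *-congʳ {t} (*-congʳ {g} (+-cong (+-congˡ {r * r} (-‿cong (*-congˡ {r} (x*u≈1 j))))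
               (*-cong (x*u≈1 j) (x*u≈1 j)))) ⟩
        (r * r - r * 1ℤ + 1ℤ) * g * t
          ≡⟨ ≡.cong (λ z → (r * r - z + 1ℤ) * g * t) (ℤ.*-identityʳ r) ⟩
        (r * r - r + 1ℤ) * g * t
          ≈⟨ inverse r (ratio^q≈1 i j) ⟩
        1ℤ ∎
        where
        a b v r g G : ℤ
        a = x i
        b = x j
        v = u j
        r = a * v
        g = sum (λ k → c k * r ^ toℕ k)
        G = sum (λ k → V i k * c k * W k j)
        series≈ : G ≈ g
        series≈ = sum-cong (λ k → V i k * c k * W k j) (λ k → c k * r ^ toℕ k) λ k → begin
          a ^ toℕ k * c k * v ^ toℕ k
            ≡⟨ solve 3 (λ a c v → a :* c :* v := c :* (a :* v)) ≡.refl (a ^ toℕ k) (c k) (v ^ toℕ k) ⟩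
          c k * (a ^ toℕ k * v ^ toℕ k)
            ≈⟨ *-congˡ {c k} (^-distrib-* a v (toℕ k)) ⟨
          c k * r ^ toℕ k ∎

-- The coefficients of 1 / (r² - r + 1)

module Coefficients (q : ℕ) (p-prime : Prime (suc q)) where

  open Modular q p-prime
  open import Relation.Binary.Reasoning.Setoid setoid
  open +-*-Solver

  -- Three times the coefficients of r^k, 0 ≤ k < p − 1, in the polynomial that
  -- represents 1 / (r² − r + 1) on the nonzero residues: multiplying by r² − r + 1
  -- modulo r^(p−1) − 1 gives the recurrence c (k + 2) = c (k + 1) − c k.
  c : ℕ → ℤ
  c 0 = + 1
  c 1 = + 2
  c 2 = + 1
  c 3 = -[1+ 0 ]
  c 4 = -[1+ 1 ]
  c 5 = -[1+ 0 ]
  c (suc (suc (suc (suc (suc (suc k)))))) = c k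

  -- The recurrence cancels all coefficients of the product but the two lowest, 1 and 2 - 1, and the
  -- two highest. The sum ends with coefficients 1 and -1, so the latter are 1 - (-1) = 2 and -1. At
  -- r^(p-1) = 1 the total is 1 + r + 2 - r = 3.
  series : ∀ r m → (r * r - r + 1ℤ) * sum {4 ℕ.+ m ℕ.* 6} (λ k → c (toℕ k) * r ^ toℕ k) ≈
           1ℤ + r + + 2 * r ^ (4 ℕ.+ m ℕ.* 6) - r * r ^ (4 ℕ.+ m ℕ.* 6)
  series r zero = ≈-reflexive (solve 1 (λ r →
    (r :* r :- r :+ con 1ℤ) :*
      (con (+ 1) :* con 1ℤ :+ (con (+ 2) :* (r :* con 1ℤ) :+
        (con (+ 1) :* (r :* (r :* con 1ℤ)) :+
          (con -1ℤ :* (r :* (r :* (r :* con 1ℤ))) :+ con 0ℤ)))) :=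
    con 1ℤ :+ r :+ con (+ 2) :* (r :* (r :* (r :* (r :* con 1ℤ)))) :-
      r :* (r :* (r :* (r :* (r :* con 1ℤ))))) ≡.refl r)
  series r (suc m) = begin
    Q * (period shifted)
      ≈⟨ *-congˡ {Q} (+-congˡ {+ 1 * 1ℤ} (+-congˡ {+ 2 * (r * 1ℤ)}
           (+-congˡ {+ 1 * (r * (r * 1ℤ))} (+-congˡ { -1ℤ * (r * (r * (r * 1ℤ)))}
           (+-congˡ { -[1+ 1 ] * (r * (r * (r * (r * 1ℤ))))}
           (+-congˡ { -1ℤ * (r * (r * (r * (r * (r * 1ℤ)))))} shift)))))) ⟩
    Q * (period (r⁶ * s))
      -- One period is (1 + r)² (1 - r³), and (r² - r + 1)(1 + r) = 1 + r³; together they give (1 +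
      -- r)(1 - r⁶).
      ≡⟨ solve 2 (λ r s →
           (r :* r :- r :+ con 1ℤ) :*
           (con (+ 1) :* con 1ℤ :+ (con (+ 2) :* (r :* con 1ℤ) :+
           (con (+ 1) :* (r :* (r :* con 1ℤ)) :+
           (con -1ℤ :* (r :* (r :* (r :* con 1ℤ))) :+
           (con -[1+ 1 ] :* (r :* (r :* (r :* (r :* con 1ℤ)))) :+
           (con -1ℤ :* (r :* (r :* (r :* (r :* (r :* con 1ℤ))))) :+
            (r :* (r :* (r :* (r :* (r :* r))))) :* s)))))) :=
           (con 1ℤ :+ r) :* (con 1ℤ :- r :* (r :* (r :* (r :* (r :* r))))) :+
           (r :* (r :* (r :* (r :* (r :* r))))) :* ((r :* r :- r :+ con 1ℤ) :* s)) ≡.refl r s ⟩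
    (1ℤ + r) * (1ℤ - r⁶) + r⁶ * (Q * s)
      ≈⟨ +-congˡ {(1ℤ + r) * (1ℤ - r⁶)} (*-congˡ {r⁶} (series r m)) ⟩
    (1ℤ + r) * (1ℤ - r⁶) + r⁶ * (1ℤ + r + + 2 * z - r * z)
      ≡⟨ solve 2 (λ r z →
           (con 1ℤ :+ r) :* (con 1ℤ :- r :* (r :* (r :* (r :* (r :* r))))) :+
           (r :* (r :* (r :* (r :* (r :* r))))) :* (con 1ℤ :+ r :+ con (+ 2) :* z :- r :* z) :=
           con 1ℤ :+ r :+ con (+ 2) :* (r :* (r :* (r :* (r :* (r :* (r :* z)))))) :-
           r :* (r :* (r :* (r :* (r :* (r :* (r :* z))))))) ≡.refl r z ⟩
    1ℤ + r + + 2 * z⁺ - r * z⁺ ∎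
    where
    Q r⁶ s z z⁺ shifted : ℤ
    Q = r * r - r + 1ℤ
    r⁶ = r * (r * (r * (r * (r * r))))
    s = sum {4 ℕ.+ m ℕ.* 6} (λ k → c (toℕ k) * r ^ toℕ k)
    z = r ^ (4 ℕ.+ m ℕ.* 6)
    z⁺ = r * (r * (r * (r * (r * (r * z)))))
    shifted = sum {4 ℕ.+ m ℕ.* 6} λ k → c (toℕ k) * (r * (r * (r * (r * (r * (r * r ^ toℕ k))))))

    period : ℤ → ℤ
    period a = + 1 * 1ℤ + (+ 2 * (r * 1ℤ) + (+ 1 * (r * (r * 1ℤ)) + (-1ℤ * (r * (r * (r * 1ℤ))) +
      (-[1+ 1 ] * (r * (r * (r * (r * 1ℤ)))) + (-1ℤ * (r * (r * (r * (r * (r * 1ℤ))))) + a)))))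

    shift : shifted ≈ r⁶ * s
    shift = trans
      (sum-cong {4 ℕ.+ m ℕ.* 6}
        (λ k → c (toℕ k) * (r * (r * (r * (r * (r * (r * r ^ toℕ k)))))))
        (λ k → r⁶ * (c (toℕ k) * r ^ toℕ k))
        (λ k → ≈-reflexive (solve 3 (λ c r z →
          c :* (r :* (r :* (r :* (r :* (r :* (r :* z)))))) :=
          (r :* (r :* (r :* (r :* (r :* r))))) :* (c :* z)) ≡.refl (c (toℕ k)) r (r ^ toℕ k))))
      (sym (*-distribˡ-sum {4 ℕ.+ m ℕ.* 6} r⁶ (λ k → c (toℕ k) * r ^ toℕ k)))

  -- The first four coefficients multiply to -2 and every six consecutive ones to -4, so the factor
  -- 2 of the theorem is what completes a power of -4.
  double-product : ∀ m → + 2 * product {4 ℕ.+ m ℕ.* 6} (λ k → c (toℕ k)) ≡ (-[1+ 3 ]) ^ suc m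
  double-product zero    = ≡.refl
  double-product (suc m) = ≡.trans
    (solve 1 (λ P → con (+ 2) :* (con (+ 1) :* (con (+ 2) :* (con (+ 1) :* (con -1ℤ :*
        (con -[1+ 1 ] :* (con -1ℤ :* P)))))) := con -[1+ 3 ] :* (con (+ 2) :* P))
      ≡.refl (product {4 ℕ.+ m ℕ.* 6} (λ k → c (toℕ k))))
    (≡.cong (λ P → -[1+ 3 ] * P) (double-product m))

  parity : ∀ n → ∃ λ k → n ≡ k ℕ.+ k ⊎ n ≡ suc (k ℕ.+ k)
  parity zero    = 0 , inj₁ ≡.refl
  parity (suc n) with parity n
  ... | k , inj₁ n≡2k   = k , inj₂ (≡.cong suc n≡2k)
  ... | k , inj₂ n≡1+2k = suc k , inj₁ (≡.cong suc (≡.trans n≡1+2k (≡.sym (ℕ.+-suc k k))))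


-- Reduction of rational numbers modulo p

module Reduction (q : ℕ) (p-prime : Prime (suc q)) where

  open Modular q p-prime
  open import Relation.Binary.Reasoning.Setoid setoid
  open +-*-Solver

  -- z represents the reduction of a modulo p.  The fraction witnessing this need
  -- not be in lowest terms, so that sums and products are immediate.
  record _↦_ (a : ℚ) (z : ℤ) : Set where
    field
      fraction : ℚᵘ
      equal    : toℚᵘ a ≃ fraction
      unit     : ℚᵘ.↧ fraction ≉ 0ℤ
      reduces  : ℚᵘ.↧ fraction * z ≈ ℚᵘ.↥ fraction

  reduction : RelatedDeterminants.Compatible ℚ.+-*-rawRing rawRing _↦_
  reduction = record
    { 0-rel = record { fraction = ℚᵘ.0ℚᵘ ; equal = ℚᵘ.≃-refl ; unit = 1≉0 ; reduces = refl }
    ; 1-rel = record { fraction = ℚᵘ.1ℚᵘ ; equal = ℚᵘ.≃-refl ; unit = 1≉0 ; reduces = refl }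
    ; +-rel = add
    ; *-rel = mul
    ; neg-rel = neg
    }
    where
    add : ∀ {a b y z} → a ↦ y → b ↦ z → (a ℚ.+ b) ↦ (y + z)
    add {a} {b} {y} {z} record { fraction = mkℚᵘ n d ; equal = a≃ ; unit = d≉0 ; reduces = dy≈n }
                        record { fraction = mkℚᵘ k e ; equal = b≃ ; unit = e≉0 ; reduces = ez≈k } = record
      { fraction = mkℚᵘ n d ℚᵘ.+ mkℚᵘ k e
      ; equal    = ℚᵘ.≃-trans (ℚ.toℚᵘ-homo-+ a b) (ℚᵘ.+-cong a≃ b≃)
      ; unit     = λ de≈0 → *-nonZero {D} {E} d≉0 e≉0 (trans (≈-reflexive (≡.sym D*E)) de≈0)
      ; reduces  = begin
          + (suc d ℕ.* suc e) * (y + z)  ≡⟨ ≡.cong (λ f → f * (y + z)) D*E ⟩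
          D * E * (y + z)                ≡⟨ solve 4 (λ D E y z → D :* E :* (y :+ z) :=
                                              D :* y :* E :+ E :* z :* D) ≡.refl D E y z ⟩
          D * y * E + E * z * D          ≈⟨ +-cong (*-congʳ {E} dy≈n) (*-congʳ {D} ez≈k) ⟩
          n * E + k * D                  ∎
      }
      where
      D E : ℤ
      D = + suc d
      E = + suc e
      D*E : + (suc d ℕ.* suc e) ≡ D * E
      D*E = ℤ.pos-* (suc d) (suc e)

    mul : ∀ {a b y z} → a ↦ y → b ↦ z → (a ℚ.* b) ↦ (y * z)
    mul {a} {b} {y} {z} record { fraction = mkℚᵘ n d ; equal = a≃ ; unit = d≉0 ; reduces = dy≈n }
                        record { fraction = mkℚᵘ k e ; equal = b≃ ; unit = e≉0 ; reduces = ez≈k } = record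
      { fraction = mkℚᵘ n d ℚᵘ.* mkℚᵘ k e
      ; equal    = ℚᵘ.≃-trans (ℚ.toℚᵘ-homo-* a b) (ℚᵘ.*-cong a≃ b≃)
      ; unit     = λ de≈0 → *-nonZero {D} {E} d≉0 e≉0 (trans (≈-reflexive (≡.sym D*E)) de≈0)
      ; reduces  = begin
          + (suc d ℕ.* suc e) * (y * z)  ≡⟨ ≡.cong (λ f → f * (y * z)) D*E ⟩
          D * E * (y * z)                ≡⟨ solve 4 (λ D E y z → D :* E :* (y :* z) :=
                                              D :* y :* (E :* z)) ≡.refl D E y z ⟩
          D * y * (E * z)                ≈⟨ *-cong dy≈n ez≈k ⟩
          n * k                          ∎
      }
      where
      D E : ℤ
      D = + suc d
      E = + suc e
      D*E : + (suc d ℕ.* suc e) ≡ D * E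
      D*E = ℤ.pos-* (suc d) (suc e)

    neg : ∀ {a z} → a ↦ z → (ℚ.- a) ↦ (- z)
    neg {a} {z} record { fraction = mkℚᵘ n d ; equal = a≃ ; unit = d≉0 ; reduces = dz≈n } = record
      { fraction = ℚᵘ.- mkℚᵘ n d
      ; equal    = ℚᵘ.≃-trans (ℚ.toℚᵘ-homo‿- a) (ℚᵘ.-‿cong a≃)
      ; unit     = d≉0
      ; reduces  = trans (≈-reflexive (≡.sym (ℤ.neg-distribʳ-* (+ suc d) z))) (-‿cong dz≈n)
      }

  open RelatedDeterminants.Compatible reduction using (det-rel; *-rel)
  open Determinant rawRing using (Matrix; det)

  integer-↦ : ∀ a → (a / 1) ↦ a
  integer-↦ a = record
    { fraction = mkℚᵘ a 0
    ; equal    = ℚ.toℚᵘ-fromℚᵘ (mkℚᵘ a 0)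
    ; unit     = 1≉0
    ; reduces  = ≈-reflexive (ℤ.*-identityˡ a)
    }

  -- Positivity makes `f` itself a legitimate denominator, so the witness is 1/f as it stands; `f`
  -- is a unit modulo p because it has the inverse `z`.
  inverse-↦ : ∀ f .{{_ : ℚ.NonZero (f / 1)}} → 0ℤ ℤ.< f → ∀ {z} → f * z ≈ 1ℤ → (1/ (f / 1)) ↦ z
  inverse-↦ f@(+[1+ n ]) _ {z} fz≈1 = record
    { fraction = mkℚᵘ 1ℤ n
    ; equal    = 1/f≃ (1/ (f / 1)) (ℚ.*-inverseˡ (f / 1))
    ; unit     = λ f≈0 → 1≉0 (trans (sym fz≈1) (*-congʳ {z} f≈0))
    ; reduces  = fz≈1
    }
    where
    -- The reciprocal is used only through a f = 1: `f / 1` is normalised by a gcd, so `1/_` does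
    -- not compute on it.
    1/f≃ : ∀ a → a ℚ.* (f / 1) ≡ ℚ.1ℚ → toℚᵘ a ≃ mkℚᵘ 1ℤ n
    1/f≃ a@(mkℚ k d _) af≡1 = cross (ℚᵘ.≃-trans (ℚᵘ.≃-sym (ℚᵘ.≃-trans (ℚ.toℚᵘ-homo-* a (f / 1))
        (ℚᵘ.*-congˡ {toℚᵘ a} (ℚ.toℚᵘ-fromℚᵘ (mkℚᵘ f 0))))) (ℚᵘ.≃-reflexive (≡.cong toℚᵘ af≡1)))
      where
      cross : mkℚᵘ k d ℚᵘ.* mkℚᵘ f 0 ≃ ℚᵘ.1ℚᵘ → mkℚᵘ k d ≃ mkℚᵘ 1ℤ n
      cross (*≡* eq) = *≡* (≡.trans (≡.sym (ℤ.*-identityʳ (k * f))) (≡.trans eq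
        (≡.cong (λ e → 1ℤ * + e) (ℕ.*-identityʳ (suc d)))))

  2*det-T-↦ : ∀ (S : Matrix q q) →
              (∀ i j → form +[1+ toℕ i ] +[1+ toℕ j ] * S i j ≈ 1ℤ) →
              ((+ 2 / 1) ℚ.* Defs.det (T (suc q))) ↦ (+ 2 * det S)
  2*det-T-↦ S form*S≈1 = *-rel (integer-↦ (+ 2)) (det-rel λ i j →
    inverse-↦ _ {{_}} (form-positive (toℕ i) (toℕ j)) (form*S≈1 i j))

  -- Cross multiplication carries the congruence from the witnessing fraction to lowest terms, after
  -- which the denominator D, a unit modulo p, is cancelled.
  reducesTo : ∀ {a z} → a ↦ z → ∀ (k : Fin (suc q)) → + toℕ k ≈ z → ReducesTo (suc q) a k
  reducesTo {a} {z} record { fraction = v ; equal = a≃v ; unit = v≉0 ; reduces = vz≈v } k k≈z =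
    p∤↧a a cross , ℤ.∣⇒∣ᵤ (_≈_.p∣a-b (*-cancelˡ-≈ {D} v≉0 (begin
      D * (ℚ.↧ a * K)   ≡⟨ solve 3 (λ d e k → d :* (e :* k) := e :* (d :* k)) ≡.refl D (ℚ.↧ a) K ⟩
      ℚ.↧ a * (D * K)   ≈⟨ *-congˡ {ℚ.↧ a} (trans (*-congˡ {D} k≈z) vz≈v) ⟩
      ℚ.↧ a * ℚᵘ.↥ v    ≡⟨ ℤ.*-comm (ℚ.↧ a) (ℚᵘ.↥ v) ⟩
      ℚᵘ.↥ v * ℚ.↧ a    ≡⟨ cross ⟨
      ℚ.↥ a * D         ≡⟨ ℤ.*-comm (ℚ.↥ a) D ⟩
      D * ℚ.↥ a         ∎)))
    where
    D K : ℤ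
    D = ℚᵘ.↧ v
    K = + toℕ k

    cross : ℚ.↥ a * D ≡ ℚᵘ.↥ v * ℚ.↧ a
    cross = unfold a a≃v
      where
      unfold : ∀ a → toℚᵘ a ≃ v → ℚ.↥ a * D ≡ ℚᵘ.↥ v * ℚ.↧ a
      unfold (mkℚ _ _ _) (*≡* eq) = eq

    -- If p divided the denominator of `a`, it would divide n D and hence n, although the fraction
    -- is in lowest terms.
    p∤↧a : ∀ a → ℚ.↥ a * D ≡ ℚᵘ.↥ v * ℚ.↧ a → ¬ (suc q ℕ.∣ ℚ.↧ₙ a)
    p∤↧a a@(mkℚ n d coprime) cross p∣d = [ p∤n , v≉0 ]′ (zero-product n D (begin
        n * D               ≡⟨ cross ⟩
        ℚᵘ.↥ v * + suc d    ≈⟨ *-congˡ {ℚᵘ.↥ v} (∣⇒≈0 {+ suc d} p∣d) ⟩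
        ℚᵘ.↥ v * 0ℤ         ≡⟨ ℤ.*-zeroʳ (ℚᵘ.↥ v) ⟩
        0ℤ                  ∎))
      where
      p∤n : n ≉ 0ℤ
      p∤n n≈0 = ℕ.nonTrivial⇒≢1 {{prime⇒nonTrivial p-prime}}
        (Coprimality.recompute coprime (≈0⇒∣ n≈0 , p∣d))

  quadraticResidue : ∀ {a z} → a ↦ z → NonZeroSquare z →
                     IsQuadraticResidue (suc q) {{prime⇒nonZero p-prime}} a
  quadraticResidue {a} {z} a↦z (square y y≉0 y²≈z) =
    k , reducesTo a↦z k k≈z , k≢0 , r , ≡.refl
    where
    -- The root is reduced first and `k` is defined as its square modulo p, so that the required
    -- equation between them holds by `refl`.
    r k : Fin (suc q)
    r = fromℕ< (ℤ.n%ℕd<d y (suc q))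
    k = (toℕ r ℕ.* toℕ r) ℕ.mod suc q

    r≈y : + toℕ r ≈ y
    r≈y = sym (multiple (y ℤ./ℕ suc q) (≡.trans
      (≡.cong₂ (λ s t → s - + t) (ℤ.a≡a%ℕn+[a/ℕn]*n y (suc q)) (Fin.toℕ-fromℕ< (ℤ.n%ℕd<d y (suc q))))
      (solve 2 (λ s t → s :+ t :- s := t) ≡.refl (+ (y ℤ.%ℕ suc q)) (y ℤ./ℕ suc q * + suc q))))

    k≈z : + toℕ k ≈ z
    k≈z = begin
      + toℕ k                   ≡⟨ ≡.cong +_ (Fin.toℕ-fromℕ< (ℕ.m%n<n r² (suc q))) ⟩
      + (r² ℕ.% suc q)          ≈⟨ multiple (+ (r² ℕ./ suc q)) (≡.trans
        (≡.cong (λ s → s - + (r² ℕ.% suc q)) (≡.trans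
          (≡.cong +_ (ℕ.m≡m%n+[m/n]*n r² (suc q)))
          (≡.cong (λ t → + (r² ℕ.% suc q) + t) (ℤ.pos-* (r² ℕ./ suc q) (suc q)))))
        (solve 2 (λ s t → s :+ t :- s := t) ≡.refl
          (+ (r² ℕ.% suc q)) (+ (r² ℕ./ suc q) * + suc q))) ⟨
      + r²                      ≡⟨ ℤ.pos-* (toℕ r) (toℕ r) ⟩
      + toℕ r * + toℕ r         ≈⟨ *-cong r≈y r≈y ⟩
      y * y                     ≈⟨ y²≈z ⟩
      z                         ∎
      where r² = toℕ r ℕ.* toℕ r

    k≢0 : toℕ k ≢ 0
    k≢0 k≡0 = *-nonZero {y} y≉0 y≉0 (trans y²≈z (trans (sym k≈z) (≈-reflexive (≡.cong +_ k≡0))))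

-- The case p = 5 + 6m

module _ (q m : ℕ) (q≡4+6m : q ≡ 4 ℕ.+ m ℕ.* 6) (p-prime : Prime (suc q)) where

  open Modular q p-prime
  open UnitMatrices q p-prime
  open Coefficients q p-prime
  open Reduction q p-prime
  open import Relation.Binary.Reasoning.Setoid setoid

  private
    half : ℕ
    half = 2 ℕ.+ m ℕ.* 3

    q≡half+half : q ≡ half ℕ.+ half
    q≡half+half = ≡.trans q≡4+6m
      (solve 1 (λ m → con 4 :+ m :* con 6 := (con 2 :+ m :* con 3) :+ (con 2 :+ m :* con 3)) ≡.refl m)
      where open ℕ.+-*-Solver

    -- 3 t = p + 1.
    t : ℤ
    t = + 2 + + m * + 2

    3t≈1 : + 3 * t ≈ 1ℤ
    3t≈1 = multiple 1ℤ (≡.trans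
      (solve 1 (λ m → con (+ 3) :* (con (+ 2) :+ m :* con (+ 2)) :- con 1ℤ :=
        con 1ℤ :* (con (+ 5) :+ m :* con (+ 6))) ≡.refl (+ m))
      (≡.cong (λ a → 1ℤ * a) (≡.trans (≡.cong (λ a → + 5 + a) (≡.sym (ℤ.pos-* m 6)))
        (≡.cong (λ n → +[1+ n ]) (≡.sym q≡4+6m)))))
      where open +-*-Solver

    t≉0 : t ≉ 0ℤ
    t≉0 t≈0 = 1≉0 (trans (sym 3t≈1) (*-congˡ {+ 3} t≈0))

    inverse : ∀ r → r ^ q ≈ 1ℤ →
              (r * r - r + 1ℤ) * sum {q} (λ k → c (toℕ k) * r ^ toℕ k) * t ≈ 1ℤ
    inverse r r^q≈1 = begin
      (r * r - r + 1ℤ) * sum {q} (λ k → c (toℕ k) * r ^ toℕ k) * t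
        ≈⟨ *-congʳ {t} (≡.subst (λ n → (r * r - r + 1ℤ) * sum {n} (λ k → c (toℕ k) * r ^ toℕ k) ≈
             1ℤ + r + + 2 * r ^ n - r * r ^ n) (≡.sym q≡4+6m) (series r m)) ⟩
      (1ℤ + r + + 2 * r ^ q - r * r ^ q) * t
        ≈⟨ *-congʳ {t} (+-cong (+-congˡ {1ℤ + r} (*-congˡ {+ 2} r^q≈1)) (-‿cong (*-congˡ {r} r^q≈1))) ⟩
      (1ℤ + r + + 2 * 1ℤ - r * 1ℤ) * t
        ≡⟨ solve 2 (λ r t → (con 1ℤ :+ r :+ con (+ 2) :* con 1ℤ :- r :* con 1ℤ) :* t :=
             con (+ 3) :* t) ≡.refl r t ⟩
      + 3 * t
        ≈⟨ 3t≈1 ⟩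
      1ℤ ∎
      where open +-*-Solver

    2≉0 : + 2 ≉ 0ℤ
    2≉0 = positive≉0 (≡.subst (1 ℕ.<_) (≡.sym q≡4+6m) (ℕ.s≤s (ℕ.s≤s ℕ.z≤n)))

    square-2*product : NonZeroSquare (+ 2 * product {q} (λ k → c (toℕ k)))
    square-2*product = ≡.subst NonZeroSquare (≡.sym (≡.trans
      (≡.cong (λ n → + 2 * product {n} (λ k → c (toℕ k))) q≡4+6m) (double-product m)))
      (power (parity m))
      where
      power : (∃ λ k → m ≡ k ℕ.+ k ⊎ m ≡ suc (k ℕ.+ k)) → NonZeroSquare (-[1+ 3 ] ^ suc m)
      -- Here p = 5 + 12k and half = 2 (1 + 3k), so -4 = -1 · 2² is itself a square.
      power (k , inj₁ m≡2k) = square-^ (suc m) (square-* { -1ℤ} {+ 2 * + 2}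
        (square-[-1] half q≡half+half (1 ℕ.+ k ℕ.* 3) (≡.trans
          (≡.cong (λ m → 2 ℕ.+ m ℕ.* 3) m≡2k)
          (solve 1 (λ k → con 2 :+ (k :+ k) :* con 3 :=
            (con 1 :+ k :* con 3) :+ (con 1 :+ k :* con 3)) ≡.refl k)))
        (square-self 2≉0))
        where open ℕ.+-*-Solver
      -- The exponent is m + 1 = 2 (k + 1), and an even power of the nonzero -4 is a square.
      power (k , inj₂ m≡1+2k) = ≡.subst (λ n → NonZeroSquare (-[1+ 3 ] ^ n))
        (≡.trans (ℕ.+-suc (suc k) k) (≡.cong suc (≡.sym m≡1+2k)))
        (square-^-even { -[1+ 3 ]} (suc k) (*-nonZero { -1ℤ} {+ 2 * + 2} -1≉0
          (*-nonZero {+ 2} 2≉0 2≉0)))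

  isQuadraticResidue : IsQuadraticResidue (suc q) {{prime⇒nonZero p-prime}}
    ((+ 2 / 1) ℚ.* Defs.det (T (suc q)))
  isQuadraticResidue = quadraticResidue
    (2*det-T-↦ (S half q≡half+half coefficients t t≉0 inverse)
      (form*S≈1 half q≡half+half coefficients t t≉0 inverse))
    (square-2*det-S half q≡half+half coefficients t t≉0 inverse square-2*product)
    where
    coefficients : Fin q → ℤ
    coefficients k = c (toℕ k)

-- The residue class of p modulo 6 and the conclusion

≡5-mod-6 : ∀ p → ¬ (2 ∣ p) → p % 3 ≡ 2 → ∃ λ m → p ≡ 5 ℕ.+ m ℕ.* 6
≡5-mod-6 p 2∤p p%3≡2 = p ℕ./ 6 , cases (p % 6) (ℕ.m%n<n p 6) (ℕ.m≡m%n+[m/n]*n p 6)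
  where
  k = p ℕ./ 6

  even : ∀ {r} → 2 ∣ r → p ≡ r ℕ.+ k ℕ.* 6 → 2 ∣ p
  even 2∣r p≡ = ≡.subst (2 ∣_) (≡.sym p≡) (ℕ.∣m∣n⇒∣m+n 2∣r (ℕ.∣n⇒∣m*n k (ℕ.divides 3 ≡.refl)))

  mod3 : ∀ r → p ≡ r ℕ.+ k ℕ.* 6 → r % 3 ≡ 2
  mod3 r p≡ = ≡.trans (≡.sym (ℕ.[m+kn]%n≡m%n r (k ℕ.* 2) 3)) (≡.trans
    (≡.cong (λ n → (r ℕ.+ n) % 3) (ℕ.*-assoc k 2 3)) (≡.trans (≡.cong (_% 3) (≡.sym p≡)) p%3≡2))

  cases : ∀ r → r ℕ.< 6 → p ≡ r ℕ.+ k ℕ.* 6 → p ≡ 5 ℕ.+ k ℕ.* 6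
  cases 0 _ p≡ = contradiction (even (ℕ.divides 0 ≡.refl) p≡) 2∤p
  cases 1 _ p≡ = contradiction (mod3 1 p≡) λ ()
  cases 2 _ p≡ = contradiction (even (ℕ.divides 1 ≡.refl) p≡) 2∤p
  cases 3 _ p≡ = contradiction (mod3 3 p≡) λ ()
  cases 4 _ p≡ = contradiction (even (ℕ.divides 2 ≡.refl) p≡) 2∤p
  cases 5 _ p≡ = p≡
  cases (suc (suc (suc (suc (suc (suc r)))))) r<6 _ =
    contradiction r<6 (ℕ.m+n≮m 6 r)

open import Data.Rational.Base using (_*_)
open import Defs using (det)

corollary1 : (p : ℕ) (p-prime : Prime p) → ¬ (2 ∣ p) → p % 3 ≡ 2 →
    IsQuadraticResidue p {{prime⇒nonZero p-prime}} ((+ 2 / 1) * det (T p))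
corollary1 zero    _       2∤0 _     = contradiction (2 ℕ.∣0) 2∤0
corollary1 (suc q) p-prime 2∤p p%3≡2 =
  let m , p≡5+6m = ≡5-mod-6 (suc q) 2∤p p%3≡2 in
  isQuadraticResidue q m (ℕ.suc-injective p≡5+6m) p-prime
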